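{- For $n\ge 1$ let $A_1(n)=\sum_{m=1}^n \log(m+1)\,e_m\left(1,\tfrac12,\ldots,\tfrac1n\right)$ and, for $r\ge 2$, let $\tilde A_r(n)=\frac{1}{r!}\sum_{l=0}^{n-1}\log(l+r+1)\, m_{[r,1^l]}\left(1,\tfrac12,\ldots,\tfrac1n\right)$. Then the limits $$\rho_1:=\lim_{n\to\infty}\frac{A_1(n)}{n\log\log n},\qquad \tilde\rho_r:=\lim_{n\to\infty}\frac{\tilde A_r(n)}{n\log\log n}\quad (r\ge 2 \text{ fixed})$$ exist, $\rho_1=1$, and for every $r\ge 2$, $$\tilde\rho_r=\frac{1}{r!}\left[(-1)^r+\sum_{j=3}^r(-1)^{r+j}\zeta(j-1)\right],$$ where the sum is empty when $r=2$.
   Context: $e_m(x_1,\ldots,x_n)$ is the $m$-th elementary symmetric polynomial. For integers $r\ge 2$, $l\ge 0$, $[r,1^l]$ denotes the partition with one part equal to $r$ and $l$ parts equal to $1$, and $m_{[r,1^l]}(x_1,\ldots,x_n)$ is the associated monomial symmetric polynomial, i.e. the sum of all distinct monomials obtained from $x_1^r x_2\cdots x_{l+1}$ by permuting the variables. $\zeta$ is the Riemann zeta function. -}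

module Defs where

open import Data.Bool.Base using (if_then_else_)
open import Data.Integer.Base as ℤ using (+_; -[1+_]; +[1+_])
import Data.Integer.Properties as ℤ
open import Data.List.Base using (List; []; _∷_; _++_; map; foldr; length; replicate; zipWith; upTo; concatMap; deduplicate)
import Data.List.Properties as List
open import Data.Nat.Base as ℕ using (ℕ; zero; suc; NonTrivial; _!)
import Data.Nat.Properties as ℕ
open import Data.Product.Base using (Σ; _×_; _,_; proj₁; proj₂; ∃-syntax)
open import Data.Rational.Base
open import Data.Rational.Properties
open import Data.Rational.Solver using (module +-*-Solver)
import Data.Rational.Unnormalised.Base as ℚᵘ
import Data.Rational.Unnormalised.Properties as ℚᵘ
open import Data.Sum.Base using (_⊎_; inj₁; inj₂)
open import Relation.Binary.PropositionalEquality using (_≡_; _≢_; refl; sym; trans; cong; cong₂; subst; subst₂)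
open import Relation.Nullary.Decidable.Core using (yes; no)
open import Relation.Nullary.Negation.Core using (contradiction)
open import Algebra.Definitions.RawSemiring +-*-rawSemiring using (_^_)

open +-*-Solver using (solve; _:=_; _:+_; _:*_; :-_; _:-_; con)

ι : ℕ → ℚ
ι n = + n / 1

κ : ℕ → ℚ
κ k = + 1 / suc k

-- Total reciprocal, with the convention inv 0 = 0.
inv : ℚ → ℚ
inv q with q ≟ 0ℚ
... | yes _   = 0ℚ
... | no  q≢0 = 1/_ q {{≢-nonZero q≢0}}

∑ : ℕ → (ℕ → ℚ) → ℚ
∑ zero    f = 0ℚ
∑ (suc n) f = ∑ n f + f n

toℚᵘ-ι : ∀ n → toℚᵘ (ι n) ℚᵘ.≃ ℚᵘ.mkℚᵘ (+ n) 0
toℚᵘ-ι n = toℚᵘ-fromℚᵘ (ℚᵘ.mkℚᵘ (+ n) 0)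

toℚᵘ-κ : ∀ n → toℚᵘ (κ n) ℚᵘ.≃ ℚᵘ.mkℚᵘ (+ 1) n
toℚᵘ-κ n = toℚᵘ-fromℚᵘ (ℚᵘ.mkℚᵘ (+ 1) n)

ι-+ : ∀ m n → ι (m ℕ.+ n) ≡ ι m + ι n
ι-+ m n = toℚᵘ-injective (ℚᵘ.≃-trans (toℚᵘ-ι (m ℕ.+ n)) (ℚᵘ.≃-sym
  (ℚᵘ.≃-trans (toℚᵘ-homo-+ (ι m) (ι n))
  (ℚᵘ.≃-trans (ℚᵘ.+-cong (toℚᵘ-ι m) (toℚᵘ-ι n))
  (ℚᵘ.*≡* (cong (ℤ._* + 1) (trans (cong₂ ℤ._+_ (ℤ.*-identityʳ (+ m)) (ℤ.*-identityʳ (+ n))) refl)))))))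

ι-* : ∀ m n → ι (m ℕ.* n) ≡ ι m * ι n
ι-* m n = toℚᵘ-injective (ℚᵘ.≃-trans (toℚᵘ-ι (m ℕ.* n)) (ℚᵘ.≃-sym
  (ℚᵘ.≃-trans (toℚᵘ-homo-* (ι m) (ι n))
  (ℚᵘ.≃-trans (ℚᵘ.*-cong (toℚᵘ-ι m) (toℚᵘ-ι n))
  (ℚᵘ.*≡* (cong (ℤ._* + 1) (sym (ℤ.pos-* m n))))))))

ι-κ : ∀ k → ι (suc k) * κ k ≡ 1ℚ
ι-κ k = toℚᵘ-injective (ℚᵘ.≃-trans (toℚᵘ-homo-* (ι (suc k)) (κ k))
  (ℚᵘ.≃-trans (ℚᵘ.*-cong (toℚᵘ-ι (suc k)) (toℚᵘ-κ k))
  (ℚᵘ.*≡* (trans (cong (ℤ._* + 1) (ℤ.*-identityʳ (+ suc k)))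
    (trans (ℤ.*-identityʳ (+ suc k)) (sym (trans (ℤ.*-identityˡ _) (ℤ.*-identityˡ _))))))))

0≤ι : ∀ n → 0ℚ ≤ ι n
0≤ι n = toℚᵘ-cancel-≤ (ℚᵘ.≤-respʳ-≃ (ℚᵘ.≃-sym (toℚᵘ-ι n))
  (ℚᵘ.*≤* (subst₂ ℤ._≤_ refl (sym (ℤ.*-identityʳ (+ n))) (ℤ.+≤+ ℕ.z≤n))))

0<κ : ∀ k → 0ℚ < κ k
0<κ k = toℚᵘ-cancel-< (ℚᵘ.<-respʳ-≃ (ℚᵘ.≃-sym (toℚᵘ-κ k)) (ℚᵘ.*<* (ℤ.+<+ (ℕ.s≤s ℕ.z≤n))))

≤-of-sub : ∀ {p q} → 0ℚ ≤ q - p → p ≤ q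
≤-of-sub {p} {q} h = subst₂ _≤_ (+-identityʳ p)
  (solve 2 (λ p q → p :+ (q :- p) := q) refl p q) (+-monoʳ-≤ p h)

sub-nonneg : ∀ {p q} → p ≤ q → 0ℚ ≤ q - p
sub-nonneg {p} {q} h = subst (_≤ q - p) (+-inverseʳ p) (+-monoˡ-≤ (- p) h)

+-nonneg : ∀ {p q} → 0ℚ ≤ p → 0ℚ ≤ q → 0ℚ ≤ p + q
+-nonneg {p} {q} a b = subst (_≤ p + q) (+-identityʳ 0ℚ) (+-mono-≤ a b)

*-nonneg : ∀ {p q} → 0ℚ ≤ p → 0ℚ ≤ q → 0ℚ ≤ p * q
*-nonneg {p} {q} a b = subst (_≤ p * q) (*-zeroʳ p) (*-monoˡ-≤-nonNeg p {{nonNegative a}} b)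

*-pos : ∀ {p q} → 0ℚ < p → 0ℚ < q → 0ℚ < p * q
*-pos {p} {q} a b = subst (_< p * q) (*-zeroʳ p) (*-monoʳ-<-pos p {{positive a}} b)

*-mono : ∀ {p q r s} → 0ℚ ≤ p → p ≤ q → 0ℚ ≤ r → r ≤ s → p * r ≤ q * s
*-mono {p} {q} {r} {s} 0≤p p≤q 0≤r r≤s = ≤-trans
  (*-monoˡ-≤-nonNeg p {{nonNegative 0≤p}} r≤s)
  (*-monoʳ-≤-nonNeg s {{nonNegative (≤-trans 0≤r r≤s)}} p≤q)

ι-mono : ∀ {m n} → m ℕ.≤ n → ι m ≤ ι n
ι-mono {m} {n} m≤n = subst₂ _≤_ (+-identityʳ (ι m))
  (trans (sym (ι-+ m (n ℕ.∸ m))) (cong ι (ℕ.m+[n∸m]≡n m≤n)))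
  (+-monoʳ-≤ (ι m) (0≤ι (n ℕ.∸ m)))

κ-anti : ∀ {m n} → m ℕ.≤ n → κ n ≤ κ m
κ-anti {m} {n} m≤n = subst₂ _≤_
  (trans (solve 3 (λ a b c → a :* (b :* c) := a :* (b :* c)) refl (κ n) (ι (suc m)) (κ m))
    (trans (cong (κ n *_) (ι-κ m)) (*-identityʳ (κ n))))
  (trans (solve 3 (λ a b c → a :* (b :* c) := (b :* a) :* c) refl (κ n) (ι (suc n)) (κ m))
    (trans (cong (_* κ m) (ι-κ n)) (*-identityˡ (κ m))))
  (*-monoˡ-≤-nonNeg (κ n) {{nonNegative (<⇒≤ (0<κ n))}}
    (*-monoʳ-≤-nonNeg (κ m) {{nonNegative (<⇒≤ (0<κ m))}} (ι-mono (ℕ.s≤s m≤n))))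

archimedean : ∀ ε → 0ℚ < ε → ∃[ N ] (∀ k → N ℕ.≤ k → κ k ≤ ε)
archimedean (mkℚ (+ 0) d c) 0<ε = contradiction (drop-*<* 0<ε) λ { (ℤ.+<+ ()) }
archimedean (mkℚ -[1+ n ] d c) 0<ε = contradiction (drop-*<* 0<ε) λ ()
archimedean (mkℚ (+[1+ n ]) d c) 0<ε = d , λ k d≤k → ≤-trans (κ-anti d≤k)
  (toℚᵘ-cancel-≤ (ℚᵘ.≤-respˡ-≃ (ℚᵘ.≃-sym (toℚᵘ-κ d))
    (ℚᵘ.*≤* (ℤ.*-monoʳ-≤-nonNeg (+ suc d) {+ 1} {+[1+ n ]} (ℤ.+≤+ (ℕ.s≤s ℕ.z≤n))))))

p≤p+q : ∀ p {q} → 0ℚ ≤ q → p ≤ p + q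
p≤p+q p {q} 0≤q = subst (_≤ p + q) (+-identityʳ p) (+-monoʳ-≤ p 0≤q)

+-pos : ∀ p q → 0ℚ < p → 0ℚ < q → 0ℚ < p + q
+-pos p q 0<p 0<q = <-≤-trans 0<p (p≤p+q p (<⇒≤ 0<q))

∣p∣≤ : ∀ {p q} → p ≤ q → - p ≤ q → ∣ p ∣ ≤ q
∣p∣≤ {p} {q} a b with ∣p∣≡p∨∣p∣≡-p p
... | inj₁ e = subst (_≤ q) (sym e) a
... | inj₂ e = subst (_≤ q) (sym e) b

p≤∣p∣ : ∀ p → p ≤ ∣ p ∣
p≤∣p∣ p with ≤-total 0ℚ p
... | inj₁ a = ≤-reflexive (sym (0≤p⇒∣p∣≡p a))
... | inj₂ a = ≤-trans a (0≤∣p∣ p)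

∣p-q∣≡∣q-p∣ : ∀ p q → ∣ p - q ∣ ≡ ∣ q - p ∣
∣p-q∣≡∣q-p∣ p q = trans (cong ∣_∣ (solve 2 (λ p q → p :- q := :- (q :- p)) refl p q)) (∣-p∣≡∣p∣ (q - p))

∣-∣-triangle : ∀ p q r → ∣ p - r ∣ ≤ ∣ p - q ∣ + ∣ q - r ∣
∣-∣-triangle p q r = subst (λ z → ∣ z ∣ ≤ ∣ p - q ∣ + ∣ q - r ∣)
  (solve 3 (λ p q r → (p :- q) :+ (q :- r) := p :- r) refl p q r)
  (∣p+q∣≤∣p∣+∣q∣ (p - q) (q - r))

∣p∣≤∣p-q∣+∣q∣ : ∀ p q → ∣ p ∣ ≤ ∣ p - q ∣ + ∣ q ∣
∣p∣≤∣p-q∣+∣q∣ p q = subst (λ z → ∣ z ∣ ≤ ∣ p - q ∣ + ∣ q ∣)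
  (solve 2 (λ p q → (p :- q) :+ q := p) refl p q) (∣p+q∣≤∣p∣+∣q∣ (p - q) q)

∣∣p∣-∣q∣∣≤∣p-q∣ : ∀ p q → ∣ ∣ p ∣ - ∣ q ∣ ∣ ≤ ∣ p - q ∣
∣∣p∣-∣q∣∣≤∣p-q∣ p q = ∣p∣≤ (half p q)
  (subst₂ _≤_ (solve 2 (λ a b → b :- a := :- (a :- b)) refl ∣ p ∣ ∣ q ∣) (∣p-q∣≡∣q-p∣ q p) (half q p))
  where
  half : ∀ p q → ∣ p ∣ - ∣ q ∣ ≤ ∣ p - q ∣
  half p q = subst (∣ p ∣ - ∣ q ∣ ≤_)
    (solve 2 (λ a b → (a :+ b) :- b := a) refl ∣ p - q ∣ ∣ q ∣)
    (+-monoˡ-≤ (- ∣ q ∣) (∣p∣≤∣p-q∣+∣q∣ p q))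

*-inv : ∀ q → q ≢ 0ℚ → q * inv q ≡ 1ℚ
*-inv q q≢0 with q ≟ 0ℚ
... | yes q≡0 = contradiction q≡0 q≢0
... | no  q≢0 = *-inverseʳ q {{≢-nonZero q≢0}}

pos≢0 : ∀ {q} → 0ℚ < q → q ≢ 0ℚ
pos≢0 0<q refl = <-irrefl refl 0<q

∣pos∣≢0 : ∀ {c q} → 0ℚ < c → c ≤ ∣ q ∣ → q ≢ 0ℚ
∣pos∣≢0 0<c c≤ refl = <-irrefl refl (<-≤-trans 0<c c≤)

0<inv : ∀ {q} → 0ℚ < q → 0ℚ < inv q
0<inv {q} 0<q with q ≟ 0ℚ
... | yes q≡0 = contradiction q≡0 (pos≢0 0<q)
... | no  q≢0 = positive⁻¹ (1/_ q {{≢-nonZero q≢0}}) {{1/pos⇒pos q {{positive 0<q}}}}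

∣inv∣≤ : ∀ {c q} → 0ℚ < c → c ≤ ∣ q ∣ → ∣ inv q ∣ ≤ inv c
∣inv∣≤ {c} {q} 0<c c≤ = subst₂ _≤_
  (trans (*-assoc ∣ inv q ∣ c (inv c)) (trans (cong (∣ inv q ∣ *_) (*-inv c (pos≢0 0<c))) (*-identityʳ _)))
  (trans (cong (_* inv c) (trans (*-comm ∣ inv q ∣ ∣ q ∣) (trans (sym (∣p*q∣≡∣p∣*∣q∣ q (inv q))) (cong ∣_∣ (*-inv q (∣pos∣≢0 0<c c≤)))))) (*-identityˡ _))
  (*-monoʳ-≤-nonNeg (inv c) {{nonNegative (<⇒≤ (0<inv 0<c))}}
    (*-monoˡ-≤-nonNeg ∣ inv q ∣ {{nonNegative (0≤∣p∣ (inv q))}} c≤))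

inv-diff : ∀ p q → p ≢ 0ℚ → q ≢ 0ℚ → ∀ g h →
           g * inv p - h * inv q ≡ (g * q - h * p) * (inv p * inv q)
inv-diff p q p≢0 q≢0 g h = trans
  (cong₂ _-_ (sym (trans (cong (λ z → g * inv p * z) (*-inv q q≢0)) (*-identityʳ (g * inv p))))
             (sym (trans (cong (λ z → h * inv q * z) (*-inv p p≢0)) (*-identityʳ (h * inv q)))))
  (solve 6 (λ g h p q p' q' → g :* p' :* (q :* q') :- h :* q' :* (p :* p') := (g :* q :- h :* p) :* (p' :* q'))
    refl g h p q (inv p) (inv q))

∣inv-diff∣≤ : ∀ {c} p q → 0ℚ < c → c ≤ ∣ p ∣ → c ≤ ∣ q ∣ → ∀ g h →
              ∣ g * inv p - h * inv q ∣ ≤ ∣ g * q - h * p ∣ * (inv c * inv c)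
∣inv-diff∣≤ {c} p q 0<c c≤p c≤q g h =
  subst (_≤ ∣ g * q - h * p ∣ * (inv c * inv c))
    (sym (trans (cong ∣_∣ (inv-diff p q (∣pos∣≢0 0<c c≤p) (∣pos∣≢0 0<c c≤q) g h))
      (trans (∣p*q∣≡∣p∣*∣q∣ (g * q - h * p) (inv p * inv q)) (cong (∣ g * q - h * p ∣ *_) (∣p*q∣≡∣p∣*∣q∣ (inv p) (inv q))))))
    (*-monoˡ-≤-nonNeg ∣ g * q - h * p ∣ {{nonNegative (0≤∣p∣ (g * q - h * p))}}
      (*-mono (0≤∣p∣ (inv p)) (∣inv∣≤ 0<c c≤p) (0≤∣p∣ (inv q)) (∣inv∣≤ 0<c c≤q)))

∑-cong : ∀ n {f g} → (∀ i → f i ≡ g i) → ∑ n f ≡ ∑ n g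
∑-cong zero    e = refl
∑-cong (suc n) e = cong₂ _+_ (∑-cong n e) (e n)

∑-const : ∀ n c → ∑ n (λ _ → c) ≡ ι n * c
∑-const zero    c = sym (*-zeroˡ c)
∑-const (suc n) c = trans (cong₂ _+_ (∑-const n c) (sym (*-identityˡ c)))
  (trans (sym (*-distribʳ-+ c (ι n) 1ℚ))
    (cong (_* c) (trans (sym (ι-+ n 1)) (cong ι (ℕ.+-comm n 1)))))

∑-split : ∀ m n f → ∑ (m ℕ.+ n) f ≡ ∑ m f + ∑ n (λ j → f (m ℕ.+ j))
∑-split m zero    f = trans (cong (λ k → ∑ k f) (ℕ.+-identityʳ m)) (sym (+-identityʳ _))
∑-split m (suc n) f = trans (cong (λ k → ∑ k f) (ℕ.+-suc m n))
  (trans (cong (_+ f (m ℕ.+ n)) (∑-split m n f)) (+-assoc (∑ m f) (∑ n (λ j → f (m ℕ.+ j))) (f (m ℕ.+ n))))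

∑-regroup : ∀ K M f → ∑ (K ℕ.* M) f ≡ ∑ K (λ i → ∑ M (λ j → f (i ℕ.* M ℕ.+ j)))
∑-regroup zero    M f = refl
∑-regroup (suc K) M f = trans (cong (λ k → ∑ k f) (ℕ.+-comm M (K ℕ.* M)))
  (trans (∑-split (K ℕ.* M) M f) (cong (_+ ∑ M (λ j → f (K ℕ.* M ℕ.+ j))) (∑-regroup K M f)))

∑-diff≤ : ∀ n f g b → (∀ i → i ℕ.< n → ∣ f i - g i ∣ ≤ b) → ∣ ∑ n f - ∑ n g ∣ ≤ ι n * b
∑-diff≤ zero    f g b h = ≤-reflexive (sym (*-zeroˡ b))
∑-diff≤ (suc n) f g b h = ≤-trans
  (subst (_≤ ∣ ∑ n f - ∑ n g ∣ + ∣ f n - g n ∣)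
    (cong ∣_∣ (solve 4 (λ a b c d → (a :- c) :+ (b :- d) := (a :+ b) :- (c :+ d)) refl (∑ n f) (f n) (∑ n g) (g n)))
    (∣p+q∣≤∣p∣+∣q∣ (∑ n f - ∑ n g) (f n - g n)))
  (subst (∣ ∑ n f - ∑ n g ∣ + ∣ f n - g n ∣ ≤_)
    (trans (cong (λ z → ι n * b + z) (sym (*-identityˡ b))) (trans (sym (*-distribʳ-+ b (ι n) 1ℚ))
      (cong (_* b) (trans (sym (ι-+ n 1)) (cong ι (ℕ.+-comm n 1))))))
    (+-mono-≤ (∑-diff≤ n f g b (λ i i<n → h i (ℕ.m≤n⇒m≤1+n i<n))) (h n ℕ.≤-refl)))

IsCauchy : (ℕ → ℚ) → Set
IsCauchy x = ∀ ε → 0ℚ < ε → ∃[ N ] (∀ m n → N ℕ.≤ m → N ℕ.≤ n → ∣ x m - x n ∣ ≤ ε)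

-- Real numbers are Cauchy sequences of rationals carrying a modulus of convergence,
-- with pointwise operations. No equality is imposed: _<ᴿ_, and hence convergence,
-- only sees a sequence up to null sequences.
record ℝ : Set where
  constructor mkℝ
  field
    approx   : ℕ → ℚ
    isCauchy : IsCauchy approx

open ℝ public

isCauchy-rescale : ∀ x C → 0ℚ < C →
  (∀ ε → 0ℚ < ε → ∃[ N ] (∀ m n → N ℕ.≤ m → N ℕ.≤ n → ∣ x m - x n ∣ ≤ C * ε)) → IsCauchy x
isCauchy-rescale x C 0<C h ε 0<ε with h (inv C * ε) (*-pos (0<inv 0<C) 0<ε)
... | N , p = N , λ m n a b → subst (∣ x m - x n ∣ ≤_)
  (trans (sym (*-assoc C (inv C) ε)) (trans (cong (_* ε) (*-inv C (pos≢0 0<C))) (*-identityˡ ε)))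
  (p m n a b)

eventually-bounded : ∀ x → IsCauchy x → ∃[ B ] (0ℚ < B × ∃[ N ] (∀ k → N ℕ.≤ k → ∣ x k ∣ ≤ B))
eventually-bounded x c with c 1ℚ (positive⁻¹ 1ℚ)
... | N , p = 1ℚ + ∣ x N ∣ , <-≤-trans (positive⁻¹ 1ℚ) (p≤p+q 1ℚ (0≤∣p∣ (x N))) , N ,
  λ k N≤k → ≤-trans (∣p∣≤∣p-q∣+∣q∣ (x k) (x N)) (+-monoˡ-≤ ∣ x N ∣ (p k N N≤k ℕ.≤-refl))


+-cauchy : ∀ x y → IsCauchy x → IsCauchy y → IsCauchy (λ k → x k + y k)
+-cauchy x y cx cy = isCauchy-rescale (λ k → x k + y k) (1ℚ + 1ℚ) (positive⁻¹ (1ℚ + 1ℚ)) cauchy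
  where
  cauchy : ∀ ε → 0ℚ < ε → ∃[ N ] (∀ m n → N ℕ.≤ m → N ℕ.≤ n → ∣ (x m + y m) - (x n + y n) ∣ ≤ (1ℚ + 1ℚ) * ε)
  cauchy ε 0<ε with cx ε 0<ε | cy ε 0<ε
  ... | M , p | N , q = M ℕ.⊔ N , λ m n a b → ≤-trans
    (subst (_≤ ∣ x m - x n ∣ + ∣ y m - y n ∣)
      (cong ∣_∣ (solve 4 (λ a b c d → (a :- c) :+ (b :- d) := (a :+ b) :- (c :+ d)) refl (x m) (y m) (x n) (y n)))
      (∣p+q∣≤∣p∣+∣q∣ (x m - x n) (y m - y n)))
    (subst (∣ x m - x n ∣ + ∣ y m - y n ∣ ≤_)
      (sym (trans (*-distribʳ-+ ε 1ℚ 1ℚ) (cong₂ _+_ (*-identityˡ ε) (*-identityˡ ε))))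
      (+-mono-≤ (p m n (ℕ.m⊔n≤o⇒m≤o M N a) (ℕ.m⊔n≤o⇒m≤o M N b)) (q m n (ℕ.m⊔n≤o⇒n≤o M N a) (ℕ.m⊔n≤o⇒n≤o M N b))))

neg-cauchy : ∀ x → IsCauchy x → IsCauchy (λ k → - x k)
neg-cauchy x cx ε 0<ε = proj₁ (cx ε 0<ε) , λ m n a b → subst (_≤ ε)
  (trans (sym (∣-p∣≡∣p∣ (x m - x n))) (cong ∣_∣ (solve 2 (λ a b → :- (a :- b) := :- a :- :- b) refl (x m) (x n))))
  (proj₂ (cx ε 0<ε) m n a b)

∣-∣-cauchy : ∀ x → IsCauchy x → IsCauchy (λ k → ∣ x k ∣)
∣-∣-cauchy x cx ε 0<ε = proj₁ (cx ε 0<ε) , λ m n a b →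
  ≤-trans (∣∣p∣-∣q∣∣≤∣p-q∣ (x m) (x n)) (proj₂ (cx ε 0<ε) m n a b)

*-diff≤ : ∀ a b c d {A B ε} → ∣ a ∣ ≤ A → ∣ d ∣ ≤ B → ∣ a - c ∣ ≤ ε → ∣ b - d ∣ ≤ ε →
          ∣ a * b - c * d ∣ ≤ (A + B) * ε
*-diff≤ a b c d {A} {B} {ε} ∣a∣≤A ∣d∣≤B ac bd = begin
  ∣ a * b - c * d ∣                          ≡⟨ cong ∣_∣ regroup ⟩
  ∣ a * (b - d) + d * (a - c) ∣              ≤⟨ ∣p+q∣≤∣p∣+∣q∣ (a * (b - d)) (d * (a - c)) ⟩
  ∣ a * (b - d) ∣ + ∣ d * (a - c) ∣          ≡⟨ cong₂ _+_ (∣p*q∣≡∣p∣*∣q∣ a (b - d)) (∣p*q∣≡∣p∣*∣q∣ d (a - c)) ⟩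
  ∣ a ∣ * ∣ b - d ∣ + ∣ d ∣ * ∣ a - c ∣      ≤⟨ +-mono-≤ {∣ a ∣ * ∣ b - d ∣} {A * ε} {∣ d ∣ * ∣ a - c ∣} {B * ε}
                                                  (*-mono (0≤∣p∣ a) ∣a∣≤A (0≤∣p∣ (b - d)) bd)
                                                  (*-mono (0≤∣p∣ d) ∣d∣≤B (0≤∣p∣ (a - c)) ac) ⟩
  A * ε + B * ε                              ≡⟨ sym (*-distribʳ-+ ε A B) ⟩
  (A + B) * ε                                ∎
  where
  open ≤-Reasoning
  regroup : a * b - c * d ≡ a * (b - d) + d * (a - c)
  regroup = solve 4 (λ a b c d → a :* b :- c :* d := a :* (b :- d) :+ d :* (a :- c)) refl a b c d

*-cauchy-step : ∀ x y → IsCauchy x → IsCauchy y → ∀ A B K L →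
  (∀ k → K ℕ.≤ k → ∣ x k ∣ ≤ A) → (∀ k → L ℕ.≤ k → ∣ y k ∣ ≤ B) →
  ∀ ε → 0ℚ < ε → ∃[ N ] (∀ m n → N ℕ.≤ m → N ℕ.≤ n → ∣ x m * y m - x n * y n ∣ ≤ (A + B) * ε)
*-cauchy-step x y cx cy A B K L ∣x∣≤A ∣y∣≤B ε 0<ε with cx ε 0<ε | cy ε 0<ε
... | M , p | N , q = (K ℕ.⊔ L) ℕ.⊔ (M ℕ.⊔ N) , λ m n a b →
    let KL≤m = ℕ.m⊔n≤o⇒m≤o (K ℕ.⊔ L) (M ℕ.⊔ N) a
        KL≤n = ℕ.m⊔n≤o⇒m≤o (K ℕ.⊔ L) (M ℕ.⊔ N) b
        MN≤m = ℕ.m⊔n≤o⇒n≤o (K ℕ.⊔ L) (M ℕ.⊔ N) a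
        MN≤n = ℕ.m⊔n≤o⇒n≤o (K ℕ.⊔ L) (M ℕ.⊔ N) b
    in *-diff≤ (x m) (y m) (x n) (y n) {A} {B} {ε}
         (∣x∣≤A m (ℕ.m⊔n≤o⇒m≤o K L KL≤m)) (∣y∣≤B n (ℕ.m⊔n≤o⇒n≤o K L KL≤n))
         (p m n (ℕ.m⊔n≤o⇒m≤o M N MN≤m) (ℕ.m⊔n≤o⇒m≤o M N MN≤n))
         (q m n (ℕ.m⊔n≤o⇒n≤o M N MN≤m) (ℕ.m⊔n≤o⇒n≤o M N MN≤n))

*-cauchy : ∀ x y → IsCauchy x → IsCauchy y → IsCauchy (λ k → x k * y k)
*-cauchy x y cx cy =
  let A , 0<A , K , ∣x∣≤A = eventually-bounded x cx
      B , 0<B , L , ∣y∣≤B = eventually-bounded y cy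
  in isCauchy-rescale (λ k → x k * y k) (A + B) (+-pos A B 0<A 0<B)
       (*-cauchy-step x y cx cy A B K L ∣x∣≤A ∣y∣≤B)

inv-cauchy : ∀ x → IsCauchy x →
  ∃[ c ] (0ℚ < c × ∃[ N ] (∀ k → N ℕ.≤ k → c ≤ ∣ x k ∣)) → IsCauchy (λ k → inv (x k))
inv-cauchy x cx (c , 0<c , N , c≤∣x∣) =
  isCauchy-rescale (λ k → inv (x k)) (inv c * inv c) (*-pos (0<inv 0<c) (0<inv 0<c)) cauchy
  where
  cauchy : ∀ ε → 0ℚ < ε → ∃[ K ] (∀ m n → K ℕ.≤ m → K ℕ.≤ n → ∣ inv (x m) - inv (x n) ∣ ≤ (inv c * inv c) * ε)
  cauchy ε 0<ε with cx ε 0<ε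
  ... | M , p = M ℕ.⊔ N , λ m n a b → subst₂ _≤_
    (cong ∣_∣ (cong₂ _-_ (*-identityˡ (inv (x m))) (*-identityˡ (inv (x n)))))
    (*-comm ε (inv c * inv c))
    (≤-trans
      (∣inv-diff∣≤ (x m) (x n) 0<c (c≤∣x∣ m (ℕ.m⊔n≤o⇒n≤o M N a)) (c≤∣x∣ n (ℕ.m⊔n≤o⇒n≤o M N b)) 1ℚ 1ℚ)
      (*-monoʳ-≤-nonNeg (inv c * inv c) {{nonNegative (<⇒≤ (*-pos (0<inv 0<c) (0<inv 0<c)))}}
        (subst (_≤ ε) (trans (∣p-q∣≡∣q-p∣ (x m) (x n)) (cong ∣_∣ (sym (cong₂ _-_ (*-identityˡ (x n)) (*-identityˡ (x m))))))
          (p m n (ℕ.m⊔n≤o⇒m≤o M N a) (ℕ.m⊔n≤o⇒m≤o M N b)))))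

infixl 6 _+ᴿ_ _-ᴿ_
infixl 7 _*ᴿ_
infix  8 -ᴿ_
infix  4 _<ᴿ_ _#_

fromℚ : ℚ → ℝ
fromℚ q = mkℝ (λ _ → q) λ ε 0<ε → 0 , λ m n _ _ →
  ≤-trans (≤-reflexive (cong ∣_∣ (+-inverseʳ q))) (<⇒≤ 0<ε)

fromℕ : ℕ → ℝ
fromℕ n = fromℚ (ι n)

0ᴿ 1ᴿ : ℝ
0ᴿ = fromℚ 0ℚ
1ᴿ = fromℚ 1ℚ

_+ᴿ_ : ℝ → ℝ → ℝ
x +ᴿ y = mkℝ (λ k → approx x k + approx y k) (+-cauchy (approx x) (approx y) (isCauchy x) (isCauchy y))

_*ᴿ_ : ℝ → ℝ → ℝ
x *ᴿ y = mkℝ (λ k → approx x k * approx y k) (*-cauchy (approx x) (approx y) (isCauchy x) (isCauchy y))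

-ᴿ_ : ℝ → ℝ
-ᴿ_ x = mkℝ (λ k → - approx x k) (neg-cauchy (approx x) (isCauchy x))

_-ᴿ_ : ℝ → ℝ → ℝ
x -ᴿ y = x +ᴿ (-ᴿ y)

∣_∣ᴿ : ℝ → ℝ
∣ x ∣ᴿ = mkℝ (λ k → ∣ approx x k ∣) (∣-∣-cauchy (approx x) (isCauchy x))

_<ᴿ_ : ℝ → ℝ → Set
x <ᴿ y = ∃[ ε ] (0ℚ < ε × ∃[ N ] (∀ k → N ℕ.≤ k → approx x k + ε ≤ approx y k))

_#_ : ℝ → ℝ → Set
x # y = x <ᴿ y ⊎ y <ᴿ x

#0⇒∣∣-bound : ∀ x → x # 0ᴿ → ∃[ c ] (0ℚ < c × ∃[ N ] (∀ k → N ℕ.≤ k → c ≤ ∣ approx x k ∣))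
#0⇒∣∣-bound x (inj₁ (ε , 0<ε , N , p)) = ε , 0<ε , N , λ k N≤k →
  subst (ε ≤_) (∣-p∣≡∣p∣ (approx x k)) (≤-trans
    (subst₂ _≤_ (solve 2 (λ x e → (x :+ e) :- x := e) refl (approx x k) ε) (+-identityˡ (- approx x k)) (+-monoˡ-≤ (- approx x k) (p k N≤k)))
    (p≤∣p∣ (- approx x k)))
#0⇒∣∣-bound x (inj₂ (ε , 0<ε , N , p)) = ε , 0<ε , N , λ k N≤k →
  ≤-trans (≤-trans (≤-reflexive (sym (+-identityˡ ε))) (p k N≤k)) (p≤∣p∣ (approx x k))

-- Pointwise; inv 0 = 0 can only occur at finitely many indices since x is apart from 0.
_⁻¹⟨_⟩ : (x : ℝ) → x # 0ᴿ → ℝ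
x ⁻¹⟨ x#0 ⟩ = mkℝ (λ k → inv (approx x k)) (inv-cauchy (approx x) (isCauchy x) (#0⇒∣∣-bound x x#0))

∑ᴿ : ℕ → (ℕ → ℝ) → ℝ
∑ᴿ zero    f = 0ᴿ
∑ᴿ (suc n) f = ∑ᴿ n f +ᴿ f n

-- riemann q K is the left Riemann sum of ∫₁^q dt/t with K+1 equal steps of signed
-- length logStep q K, nodes 1 + i·logStep q K. For q > 0 all nodes are positive,
-- so the convention inv 0 = 0 plays no role.
logStep : ℚ → ℕ → ℚ
logStep q K = (q - 1ℚ) * κ K

riemann : ℚ → ℕ → ℚ
riemann q K = ∑ (suc K) (λ i → logStep q K * inv (1ℚ + ι i * logStep q K))

ι*κ≤1 : ∀ {i} K → i ℕ.< suc K → ι i * κ K ≤ 1ℚ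
ι*κ≤1 {i} K i<K = subst (ι i * κ K ≤_) (ι-κ K)
  (*-monoʳ-≤-nonNeg (κ K) {{nonNegative (<⇒≤ (0<κ K))}} (ι-mono (ℕ.<⇒≤ i<K)))

κ-refine : ∀ K M → ι (suc M) * κ (M ℕ.+ K ℕ.* suc M) ≡ κ K
κ-refine K M = trans (sym (*-identityˡ _)) (trans (cong (_* (ι (suc M) * κ R)) (sym (ι-κ K)))
  (trans (solve 4 (λ a b c d → (a :* b) :* (c :* d) := b :* ((a :* c) :* d)) refl (ι (suc K)) (κ K) (ι (suc M)) (κ R))
    (trans (cong (κ K *_) (trans (cong (_* κ R) (sym (ι-* (suc K) (suc M)))) (ι-κ R))) (*-identityʳ (κ K)))))
  where R = M ℕ.+ K ℕ.* suc M

module _ {c : ℚ} (0<c : 0ℚ < c) (c≤1 : c ≤ 1ℚ) where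

  C² : ℚ
  C² = inv c * inv c

  0<C² : 0ℚ < C²
  0<C² = *-pos (0<inv 0<c) (0<inv 0<c)

  node-bound : ∀ q K i → c ≤ q → i ℕ.< suc K → c ≤ ∣ 1ℚ + ι i * logStep q K ∣
  node-bound q K i c≤q i<K = ≤-trans (≤-of-sub (subst (0ℚ ≤_)
    (solve 4 (λ c q i κ → (con 1ℚ :- i :* κ) :* (con 1ℚ :- c) :+ (i :* κ) :* (q :- c)
                       := (con 1ℚ :+ i :* ((q :- con 1ℚ) :* κ)) :- c) refl c q (ι i) (κ K))
    (+-nonneg (*-nonneg (sub-nonneg (ι*κ≤1 K i<K)) (sub-nonneg c≤1))
              (*-nonneg (*-nonneg (0≤ι i) (<⇒≤ (0<κ K))) (sub-nonneg c≤q)))))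
    (p≤∣p∣ _)

  riemann-lipschitz : ∀ p q K → c ≤ p → c ≤ q → ∣ riemann p K - riemann q K ∣ ≤ ∣ p - q ∣ * C²
  riemann-lipschitz p q K c≤p c≤q = subst (∣ riemann p K - riemann q K ∣ ≤_)
    (trans (solve 4 (λ a d k e → a :* ((d :* k) :* e) := (a :* k) :* (d :* e)) refl (ι (suc K)) ∣ p - q ∣ (κ K) C²)
      (trans (cong (_* (∣ p - q ∣ * C²)) (ι-κ K)) (*-identityˡ _)))
    (∑-diff≤ (suc K) _ _ (∣ p - q ∣ * κ K * C²) term)
    where
    term : ∀ i → i ℕ.< suc K →
      ∣ logStep p K * inv (1ℚ + ι i * logStep p K) - logStep q K * inv (1ℚ + ι i * logStep q K) ∣ ≤ ∣ p - q ∣ * κ K * C²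
    term i i<K = subst (∣ logStep p K * inv (1ℚ + ι i * logStep p K) - logStep q K * inv (1ℚ + ι i * logStep q K) ∣ ≤_)
      (cong (_* C²) (trans (cong ∣_∣ (solve 4 (λ p q i κ →
          (p :- con 1ℚ) :* κ :* (con 1ℚ :+ i :* ((q :- con 1ℚ) :* κ)) :- (q :- con 1ℚ) :* κ :* (con 1ℚ :+ i :* ((p :- con 1ℚ) :* κ))
          := (p :- q) :* κ) refl p q (ι i) (κ K)))
        (trans (∣p*q∣≡∣p∣*∣q∣ (p - q) (κ K)) (cong (∣ p - q ∣ *_) (0≤p⇒∣p∣≡p (<⇒≤ (0<κ K)))))))
      (∣inv-diff∣≤ _ _ 0<c (node-bound p K i c≤p i<K) (node-bound q K i c≤q i<K) (logStep p K) (logStep q K))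

  riemann-refine : ∀ q K M → c ≤ q →
    ∣ riemann q K - riemann q (M ℕ.+ K ℕ.* suc M) ∣ ≤ ∣ q - 1ℚ ∣ * ∣ q - 1ℚ ∣ * κ K * C²
  riemann-refine q K M c≤q = subst₂ _≤_
    (cong ∣_∣ (cong₂ _-_ (∑-cong (suc K) coarse) (sym (∑-regroup (suc K) (suc M) F))))
    total
    (∑-diff≤ (suc K) _ _ (ι (suc M) * (∣ g ∣ * (ι (suc M) * ∣ g ∣) * C²)) λ i i<K →
      ∑-diff≤ (suc M) (λ _ → g * inv (t i)) (λ j → F (i ℕ.* suc M ℕ.+ j)) _ λ j j<M → term i j i<K j<M)
    where
    R = M ℕ.+ K ℕ.* suc M
    g = logStep q R
    t : ℕ → ℚ
    t i = 1ℚ + ι i * logStep q K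
    F : ℕ → ℚ
    F n = g * inv (1ℚ + ι n * g)
    h≡ : ι (suc M) * g ≡ logStep q K
    h≡ = trans (solve 3 (λ m d k → m :* (d :* k) := d :* (m :* k)) refl (ι (suc M)) (q - 1ℚ) (κ R))
      (cong ((q - 1ℚ) *_) (κ-refine K M))
    coarse : ∀ i → ∑ (suc M) (λ _ → g * inv (t i)) ≡ logStep q K * inv (t i)
    coarse i = trans (∑-const (suc M) (g * inv (t i))) (trans (sym (*-assoc (ι (suc M)) g (inv (t i)))) (cong (_* inv (t i)) h≡))
    index< : ∀ i j → i ℕ.< suc K → j ℕ.< suc M → i ℕ.* suc M ℕ.+ j ℕ.< suc R
    index< i j i<K j<M = ℕ.≤-trans
      (subst (λ z → suc (i ℕ.* suc M ℕ.+ j) ℕ.≤ z) (ℕ.+-comm (i ℕ.* suc M) (suc M))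
        (subst (λ z → z ℕ.≤ i ℕ.* suc M ℕ.+ suc M) (ℕ.+-suc (i ℕ.* suc M) j) (ℕ.+-monoʳ-≤ (i ℕ.* suc M) j<M)))
      (ℕ.*-monoˡ-≤ (suc M) i<K)
    offset : ∀ i j → g * (1ℚ + ι (i ℕ.* suc M ℕ.+ j) * g) - g * t i ≡ g * (ι j * g)
    offset i j = trans
      (cong₂ (λ a b → g * (1ℚ + a * g) - g * (1ℚ + ι i * b))
        (trans (ι-+ (i ℕ.* suc M) j) (cong (_+ ι j) (ι-* i (suc M)))) (sym h≡))
      (solve 4 (λ g i m j → g :* (con 1ℚ :+ (i :* m :+ j) :* g) :- g :* (con 1ℚ :+ i :* (m :* g)) := g :* (j :* g))
        refl g (ι i) (ι (suc M)) (ι j))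
    term : ∀ i j → i ℕ.< suc K → j ℕ.< suc M →
      ∣ g * inv (t i) - F (i ℕ.* suc M ℕ.+ j) ∣ ≤ ∣ g ∣ * (ι (suc M) * ∣ g ∣) * C²
    term i j i<K j<M = ≤-trans
      (∣inv-diff∣≤ _ _ 0<c (node-bound q K i c≤q i<K) (node-bound q R (i ℕ.* suc M ℕ.+ j) c≤q (index< i j i<K j<M)) g g)
      (*-monoʳ-≤-nonNeg C² {{nonNegative (<⇒≤ 0<C²)}}
        (subst (_≤ ∣ g ∣ * (ι (suc M) * ∣ g ∣))
          (sym (trans (cong ∣_∣ (offset i j)) (trans (∣p*q∣≡∣p∣*∣q∣ g (ι j * g))
            (cong (∣ g ∣ *_) (trans (∣p*q∣≡∣p∣*∣q∣ (ι j) g) (cong (_* ∣ g ∣) (0≤p⇒∣p∣≡p (0≤ι j))))))))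
          (*-monoˡ-≤-nonNeg ∣ g ∣ {{nonNegative (0≤∣p∣ g)}}
            (*-monoʳ-≤-nonNeg ∣ g ∣ {{nonNegative (0≤∣p∣ g)}} (ι-mono (ℕ.<⇒≤ j<M))))))
    Mg≡ : ι (suc M) * ∣ g ∣ ≡ ∣ q - 1ℚ ∣ * κ K
    Mg≡ = trans (cong (_* ∣ g ∣) (sym (0≤p⇒∣p∣≡p (0≤ι (suc M))))) (trans (sym (∣p*q∣≡∣p∣*∣q∣ (ι (suc M)) g))
      (trans (cong ∣_∣ h≡) (trans (∣p*q∣≡∣p∣*∣q∣ (q - 1ℚ) (κ K)) (cong (∣ q - 1ℚ ∣ *_) (0≤p⇒∣p∣≡p (<⇒≤ (0<κ K)))))))
    total : ι (suc K) * (ι (suc M) * (∣ g ∣ * (ι (suc M) * ∣ g ∣) * C²)) ≡ ∣ q - 1ℚ ∣ * ∣ q - 1ℚ ∣ * κ K * C²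
    total = trans
      (solve 4 (λ k m g c → k :* (m :* (g :* (m :* g) :* c)) := k :* ((m :* g) :* (m :* g)) :* c) refl (ι (suc K)) (ι (suc M)) ∣ g ∣ C²)
      (trans (cong (λ z → ι (suc K) * (z * z) * C²) Mg≡)
        (trans (solve 4 (λ a d k c → a :* ((d :* k) :* (d :* k)) :* c := (a :* k) :* (d :* d :* k :* c)) refl (ι (suc K)) ∣ q - 1ℚ ∣ (κ K) C²)
          (trans (cong (_* (∣ q - 1ℚ ∣ * ∣ q - 1ℚ ∣ * κ K * C²)) (ι-κ K)) (*-identityˡ _))))

  riemann-steps : ∀ D q K M → c ≤ q → ∣ q - 1ℚ ∣ ≤ D →
    ∣ riemann q K - riemann q M ∣ ≤ D * D * κ K * C² + D * D * κ M * C²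
  riemann-steps D q K M c≤q ≤D = ≤-trans
    (∣-∣-triangle (riemann q K) (riemann q (M ℕ.+ K ℕ.* suc M)) (riemann q M))
    (+-mono-≤ (≤-trans (riemann-refine q K M c≤q) (mono K)) (≤-trans flipped (mono M)))
    where
    mono : ∀ n → ∣ q - 1ℚ ∣ * ∣ q - 1ℚ ∣ * κ n * C² ≤ D * D * κ n * C²
    mono n = *-monoʳ-≤-nonNeg C² {{nonNegative (<⇒≤ 0<C²)}} (*-monoʳ-≤-nonNeg (κ n) {{nonNegative (<⇒≤ (0<κ n))}}
      (*-mono (0≤∣p∣ (q - 1ℚ)) ≤D (0≤∣p∣ (q - 1ℚ)) ≤D))
    flipped : ∣ riemann q (M ℕ.+ K ℕ.* suc M) - riemann q M ∣ ≤ ∣ q - 1ℚ ∣ * ∣ q - 1ℚ ∣ * κ M * C²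
    flipped = subst (_≤ ∣ q - 1ℚ ∣ * ∣ q - 1ℚ ∣ * κ M * C²)
      (trans (∣p-q∣≡∣q-p∣ (riemann q M) (riemann q (K ℕ.+ M ℕ.* suc K)))
        (cong (λ R → ∣ riemann q R - riemann q M ∣) (ℕ.suc-injective (ℕ.*-comm (suc M) (suc K)))))
      (riemann-refine q M K c≤q)

  riemann-modulus : ∀ D ε p q m n → 0ℚ ≤ D → c ≤ p → c ≤ q → ∣ p - 1ℚ ∣ ≤ D → κ m ≤ ε → κ n ≤ ε → ∣ p - q ∣ ≤ ε →
    ∣ riemann p m - riemann q n ∣ ≤ (D * D * C² + (D * D * C² + C²)) * ε
  riemann-modulus D ε p q m n 0≤D c≤p c≤q ≤D κm κn pq = begin
    ∣ riemann p m - riemann q n ∣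
      ≤⟨ ∣-∣-triangle (riemann p m) (riemann p n) (riemann q n) ⟩
    ∣ riemann p m - riemann p n ∣ + ∣ riemann p n - riemann q n ∣
      ≤⟨ +-mono-≤ (riemann-steps D p m n c≤p ≤D) (riemann-lipschitz p q n c≤p c≤q) ⟩
    D * D * κ m * C² + D * D * κ n * C² + ∣ p - q ∣ * C²
      ≤⟨ +-mono-≤ (+-mono-≤ (shrink m κm) (shrink n κn)) (*-monoʳ-≤-nonNeg C² {{nonNegative (<⇒≤ 0<C²)}} pq) ⟩
    D * D * ε * C² + D * D * ε * C² + ε * C²
      ≡⟨ solve 3 (λ d e c → d :* e :* c :+ d :* e :* c :+ e :* c := (d :* c :+ (d :* c :+ c)) :* e) refl (D * D) ε C² ⟩
    (D * D * C² + (D * D * C² + C²)) * ε ∎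
    where
    open ≤-Reasoning
    shrink : ∀ n → κ n ≤ ε → D * D * κ n * C² ≤ D * D * ε * C²
    shrink n κ≤ = *-monoʳ-≤-nonNeg C² {{nonNegative (<⇒≤ 0<C²)}}
      (*-monoˡ-≤-nonNeg (D * D) {{nonNegative (*-nonneg 0≤D 0≤D)}} κ≤)

log-cauchy-step : ∀ x → IsCauchy x → ∀ {c} (0<c : 0ℚ < c) (c≤1 : c ≤ 1ℚ) D N L → 0ℚ ≤ D →
  (∀ k → N ℕ.≤ k → c ≤ x k) → (∀ k → L ℕ.≤ k → ∣ x k - 1ℚ ∣ ≤ D) →
  ∀ ε → 0ℚ < ε → ∃[ K ] (∀ m n → K ℕ.≤ m → K ℕ.≤ n → ∣ riemann (x m) m - riemann (x n) n ∣
    ≤ (D * D * C² 0<c c≤1 + (D * D * C² 0<c c≤1 + C² 0<c c≤1)) * ε)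
log-cauchy-step x cx 0<c c≤1 D N L 0≤D c≤x ≤D ε 0<ε with cx ε 0<ε | archimedean ε 0<ε
... | M , p | A , κ≤ε = (N ℕ.⊔ L) ℕ.⊔ (M ℕ.⊔ A) , λ m n a b →
  let NL≤m = ℕ.m⊔n≤o⇒m≤o (N ℕ.⊔ L) (M ℕ.⊔ A) a
      NL≤n = ℕ.m⊔n≤o⇒m≤o (N ℕ.⊔ L) (M ℕ.⊔ A) b
      MA≤m = ℕ.m⊔n≤o⇒n≤o (N ℕ.⊔ L) (M ℕ.⊔ A) a
      MA≤n = ℕ.m⊔n≤o⇒n≤o (N ℕ.⊔ L) (M ℕ.⊔ A) b
  in riemann-modulus 0<c c≤1 D ε (x m) (x n) m n 0≤D
       (c≤x m (ℕ.m⊔n≤o⇒m≤o N L NL≤m)) (c≤x n (ℕ.m⊔n≤o⇒m≤o N L NL≤n))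
       (≤D m (ℕ.m⊔n≤o⇒n≤o N L NL≤m))
       (κ≤ε m (ℕ.m⊔n≤o⇒n≤o M A MA≤m)) (κ≤ε n (ℕ.m⊔n≤o⇒n≤o M A MA≤n))
       (p m n (ℕ.m⊔n≤o⇒m≤o M A MA≤m) (ℕ.m⊔n≤o⇒m≤o M A MA≤n))

⊓-pos : ∀ p q → 0ℚ < p → 0ℚ < q → 0ℚ < p ⊓ q
⊓-pos p q 0<p 0<q with ⊓-sel p q
... | inj₁ e = subst (0ℚ <_) (sym e) 0<p
... | inj₂ e = subst (0ℚ <_) (sym e) 0<q

log-cauchy : ∀ x → IsCauchy x →
  ∃[ c ] (0ℚ < c × ∃[ N ] (∀ k → N ℕ.≤ k → c ≤ x k)) → IsCauchy (λ k → riemann (x k) k)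
log-cauchy x cx (c , 0<c , N , c≤x) =
  let D , 0<D , L , ≤D = eventually-bounded (λ k → x k - 1ℚ) (+-cauchy x (λ _ → - 1ℚ) cx (isCauchy (fromℚ (- 1ℚ))))
      0<c′ = ⊓-pos c 1ℚ 0<c (positive⁻¹ 1ℚ)
      c′≤1 = p⊓q≤q c 1ℚ
      E    = C² 0<c′ c′≤1
      0<E  = 0<C² 0<c′ c′≤1
      0<S  = *-pos (*-pos 0<D 0<D) 0<E
  in isCauchy-rescale (λ k → riemann (x k) k) (D * D * E + (D * D * E + E))
       (+-pos (D * D * E) (D * D * E + E) 0<S (+-pos (D * D * E) E 0<S 0<E))
       (log-cauchy-step x cx 0<c′ c′≤1 D N L (<⇒≤ 0<D) (λ k N≤k → ≤-trans (p⊓q≤p c 1ℚ) (c≤x k N≤k)) ≤D)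

0<⇒bound : ∀ x → 0ᴿ <ᴿ x → ∃[ c ] (0ℚ < c × ∃[ N ] (∀ k → N ℕ.≤ k → c ≤ approx x k))
0<⇒bound x (ε , 0<ε , N , p) = ε , 0<ε , N , λ k N≤k → ≤-trans (≤-reflexive (sym (+-identityˡ ε))) (p k N≤k)

-- log x = ∫₁^x dt/t: the k-th approximant uses the k-th approximant of x and k+1 steps.
log : (x : ℝ) → 0ᴿ <ᴿ x → ℝ
log x 0<x = mkℝ (λ k → riemann (approx x k) k) (log-cauchy (approx x) (isCauchy x) (0<⇒bound x 0<x))

κ-telescope : ∀ i → κ (suc i) * κ i ≡ κ i - κ (suc i)
κ-telescope i = sym (trans
  (cong₂ _-_
    (trans (sym (*-identityʳ (κ i))) (cong (κ i *_) (trans (sym (ι-κ (suc i))) (cong (_* κ (suc i)) (ι-+ 1 (suc i))))))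
    (trans (sym (*-identityˡ (κ (suc i)))) (cong (_* κ (suc i)) (sym (ι-κ i)))))
  (solve 3 (λ k k′ n → k :* ((con 1ℚ :+ n) :* k′) :- n :* k :* k′ := k′ :* k) refl (κ i) (κ (suc i)) (ι (suc i))))

κ^-bounds : ∀ i t → 0ℚ ≤ κ i ^ t × κ i ^ t ≤ 1ℚ
κ^-bounds i zero    = nonNegative⁻¹ 1ℚ , ≤-refl
κ^-bounds i (suc t) = let a , b = κ^-bounds i t in
  *-nonneg (<⇒≤ (0<κ i)) a ,
  subst (κ i * κ i ^ t ≤_) (*-identityˡ 1ℚ) (*-mono (<⇒≤ (0<κ i)) (κ-anti {0} {i} ℕ.z≤n) a b)

-- Sum of i⁻ˢ over 1 ≤ i ≤ k+1.
ζ-partial : ℕ → ℕ → ℚ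
ζ-partial s k = ∑ (suc k) (λ i → (+ 1 / suc i) ^ s)

ζ-tail : ∀ t m d → (0ℚ ≤ ζ-partial (2 ℕ.+ t) (d ℕ.+ m) - ζ-partial (2 ℕ.+ t) m)
                 × (ζ-partial (2 ℕ.+ t) (d ℕ.+ m) - ζ-partial (2 ℕ.+ t) m ≤ κ m - κ (d ℕ.+ m))
ζ-tail t m zero = ≤-reflexive (sym (+-inverseʳ (ζ-partial (2 ℕ.+ t) m))) ,
  ≤-reflexive (trans (+-inverseʳ (ζ-partial (2 ℕ.+ t) m)) (sym (+-inverseʳ (κ m))))
ζ-tail t m (suc d) = let lo , hi = ζ-tail t m d in
  subst (0ℚ ≤_) (regroup (ζ-partial (2 ℕ.+ t) j) term (ζ-partial (2 ℕ.+ t) m)) (+-nonneg lo 0≤term) ,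
  subst₂ _≤_ (regroup (ζ-partial (2 ℕ.+ t) j) term (ζ-partial (2 ℕ.+ t) m))
    (solve 3 (λ a b c → (a :- b) :+ (b :- c) := a :- c) refl (κ m) (κ j) (κ (suc j)))
    (+-mono-≤ hi term≤)
  where
  j = d ℕ.+ m
  term : ℚ
  term = κ (suc j) ^ (2 ℕ.+ t)
  regroup : ∀ a b c → (a - c) + b ≡ (a + b) - c
  regroup = solve 3 (λ a b c → (a :- c) :+ b := (a :+ b) :- c) refl
  0≤term : 0ℚ ≤ term
  0≤term = proj₁ (κ^-bounds (suc j) (2 ℕ.+ t))
  term≤ : term ≤ κ j - κ (suc j)
  term≤ = subst (term ≤_) (κ-telescope j)
    (*-monoˡ-≤-nonNeg (κ (suc j)) {{nonNegative (<⇒≤ (0<κ (suc j)))}}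
      (subst (κ (suc j) * κ (suc j) ^ t ≤_) (*-identityʳ (κ j))
        (*-mono (<⇒≤ (0<κ (suc j))) (κ-anti (ℕ.n≤1+n j)) (proj₁ (κ^-bounds (suc j) t)) (proj₂ (κ^-bounds (suc j) t)))))

ζ-close : ∀ t m n → m ℕ.≤ n → ∣ ζ-partial (2 ℕ.+ t) n - ζ-partial (2 ℕ.+ t) m ∣ ≤ κ m
ζ-close t m n m≤n = subst (λ k → ∣ ζ-partial (2 ℕ.+ t) k - ζ-partial (2 ℕ.+ t) m ∣ ≤ κ m) (ℕ.m∸n+n≡m m≤n)
  (subst (_≤ κ m) (sym (0≤p⇒∣p∣≡p (proj₁ (ζ-tail t m (n ℕ.∸ m)))))
    (≤-trans (proj₂ (ζ-tail t m (n ℕ.∸ m)))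
      (subst (κ m - κ (n ℕ.∸ m ℕ.+ m) ≤_) (+-identityʳ (κ m))
        (+-monoʳ-≤ (κ m) (neg-antimono-≤ (<⇒≤ (0<κ (n ℕ.∸ m ℕ.+ m))))))))

ζ-cauchy : ∀ s .{{_ : NonTrivial s}} → IsCauchy (ζ-partial s)
ζ-cauchy (suc (suc t)) ε 0<ε with archimedean ε 0<ε
... | N , κ≤ε = N , λ m n N≤m N≤n → close m n N≤m N≤n (ℕ.≤-total m n)
  where
  close : ∀ m n → N ℕ.≤ m → N ℕ.≤ n → m ℕ.≤ n ⊎ n ℕ.≤ m → ∣ ζ-partial (2 ℕ.+ t) m - ζ-partial (2 ℕ.+ t) n ∣ ≤ ε
  close m n N≤m N≤n (inj₁ m≤n) = subst (_≤ ε) (∣p-q∣≡∣q-p∣ (ζ-partial (2 ℕ.+ t) n) (ζ-partial (2 ℕ.+ t) m))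
    (≤-trans (ζ-close t m n m≤n) (κ≤ε m N≤m))
  close m n N≤m N≤n (inj₂ n≤m) = ≤-trans (ζ-close t n m n≤m) (κ≤ε n N≤n)

-- The Riemann zeta function at an integer s ≥ 2.
ζ : (s : ℕ) → .{{NonTrivial s}} → ℝ
ζ s = mkℝ (ζ-partial s) (ζ-cauchy s)

fromℕ-pos : ∀ n .{{_ : ℕ.NonZero n}} → 0ᴿ <ᴿ fromℕ n
fromℕ-pos (suc n) = 1ℚ , positive⁻¹ 1ℚ , 0 , λ _ _ →
  subst (_≤ ι (suc n)) (sym (+-identityˡ 1ℚ)) (ι-mono {1} {suc n} (ℕ.s≤s ℕ.z≤n))

logℕ : (n : ℕ) → .{{ℕ.NonZero n}} → ℝ
logℕ n = log (fromℕ n) (fromℕ-pos n)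

sum product : List ℚ → ℚ
sum     = foldr _+_ 0ℚ
product = foldr _*_ 1ℚ

-- All sublists of length m, by position; entries with equal values stay distinct.
choose : {A : Set} → ℕ → List A → List (List A)
choose zero    xs       = [] ∷ []
choose (suc m) []       = []
choose (suc m) (x ∷ xs) = map (x ∷_) (choose m xs) ++ choose (suc m) xs

elementary : ℕ → List ℚ → ℚ
elementary m xs = sum (map product (choose m xs))

insertions : {A : Set} → A → List A → List (List A)
insertions x []       = (x ∷ []) ∷ []
insertions x (y ∷ ys) = (x ∷ y ∷ ys) ∷ map (y ∷_) (insertions x ys)

permutations : {A : Set} → List A → List (List A)
permutations []       = [] ∷ []
permutations (x ∷ xs) = concatMap (insertions x) (permutations xs)

-- The distinct exponent vectors of length n obtained by permuting (p₁, …, p_k, 0, …, 0);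
-- there are none when n < k.
exponents : List ℕ → ℕ → List (List ℕ)
exponents p n =
  if length p ℕ.≤ᵇ n
  then deduplicate (List.≡-dec ℕ._≟_) (permutations (p ++ replicate (n ℕ.∸ length p) 0))
  else []

-- Duplicates are removed among exponent vectors, not among the rational values
-- of the monomials.
monomialSymmetric : List ℕ → List ℚ → ℚ
monomialSymmetric p xs = sum (map (λ α → product (zipWith _^_ xs α)) (exponents p (length xs)))

reciprocals : ℕ → List ℚ
reciprocals n = map (λ i → + 1 / suc i) (upTo n)

-- The summation index i stands for m = 1 + i.
A₁ : ℕ → ℝ
A₁ n = ∑ᴿ n λ i → let m = suc i in logℕ (suc m) *ᴿ fromℚ (elementary m (reciprocals n))

1/_! : ℕ → ℚ
1/ r ! = (+ 1 / (r !)) {{r ℕ.!≢0}}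

Ã : ℕ → ℕ → ℝ
Ã r n = fromℚ (1/ r !) *ᴿ
  ∑ᴿ n λ l → logℕ (suc (l ℕ.+ r)) *ᴿ fromℚ (monomialSymmetric (r ∷ replicate l 1) (reciprocals n))

-- The summation index i stands for j = 3 + i.
ρ̃ : ℕ → ℝ
ρ̃ r = fromℚ (1/ r !) *ᴿ
  (fromℚ ((- 1ℚ) ^ r) +ᴿ ∑ᴿ (r ℕ.∸ 2) λ i → let j = 3 ℕ.+ i in fromℚ ((- 1ℚ) ^ (r ℕ.+ j)) *ᴿ ζ (j ℕ.∸ 1))

nloglog : (n : ℕ) → .{{_ : ℕ.NonZero n}} → 0ᴿ <ᴿ logℕ n → ℝ
nloglog n 0<log = fromℕ n *ᴿ log (logℕ n) 0<log

-- The quotient by n log log n makes sense at n.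
record Defined (n : ℕ) : Set where
  field
    {{n≢0}} : ℕ.NonZero n
    0<log   : 0ᴿ <ᴿ logℕ n
    apart   : nloglog n 0<log # 0ᴿ

_/nloglog : (ℕ → ℝ) → (n : ℕ) → Defined n → ℝ
(a /nloglog) n d = a n *ᴿ (nloglog n 0<log ⁻¹⟨ apart ⟩)
  where open Defined d

-- Convergence of a sequence whose terms need only be defined for all large n
-- (log log 1 does not exist). That n is eventually in the domain is part of the claim.
infix 4 _⟶_

_⟶_ : {D : ℕ → Set} → ((n : ℕ) → D n → ℝ) → ℝ → Set
_⟶_ {D} a L = ∀ ε → 0ᴿ <ᴿ ε → ∃[ N ] (∀ n → N ℕ.≤ n → D n × (∀ (d : D n) → ∣ a n d -ᴿ L ∣ᴿ <ᴿ ε))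

{-# OPTIONS --safe #-}
-- Since ∏ (1 + 1/i) = n + 1 telescopes, the weights eₘ(1, 1/2, …, 1/n) / (n + 1) are the law of a
-- sum of independent Bernoulli variables with parameters 1/(i + 1). Its mean μ is log n + O(1) and its
-- variance is at most μ, so with c = μ + 1 Jensen's inequality from above and a second-order bound from
-- below give A₁(n) = (n + 1) (log c + O(1)) = (n + 1) (log log n + O(1)).
-- Fixing the variable that carries the exponent r multiplies the weights by i⁻ʳ / (1 + 1/i) and shifts the
-- argument of the logarithm by O(1). Hence r! Ãᵣ(n) = Sᵣ(n) (n + 1) (log log n + O(1)) with
-- Sᵣ(n) = ∑ i⁻ʳ / (1 + 1/i); here S₂ → 1 and Sᵣ + Sᵣ₋₁ → ζ(r − 1), which unfolds to the claimed constant.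
-- Every estimate is an exact rational inequality between the k-th approximants, valid for all k ≥ n.
module Submission where

open import Defs
open import Data.Bool.Properties using (T-≡)
import Data.Integer.Base as ℤ
open import Data.List.Base using (List; []; _∷_; _++_; map; length; replicate; zipWith; concatMap; deduplicate; applyUpTo; upTo)
open import Data.List.Membership.Propositional using (_∈_; find; lose)
open import Data.List.Membership.Propositional.Properties
open import Data.List.Membership.Propositional.Properties.WithK using (unique∧set⇒bag)
import Data.List.Properties as List
open import Data.List.Relation.Binary.BagAndSetEquality using (∼bag⇒↭)
open import Data.List.Relation.Binary.Permutation.Propositional using (_↭_; prep; swap; ↭-sym; ↭-refl; ↭-trans; ↭-reflexive)
import Data.List.Relation.Binary.Permutation.Propositional as ↭
import Data.List.Relation.Binary.Permutation.Propositional.Properties as Perm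
open import Data.List.Relation.Unary.All using (All; []; _∷_)
import Data.List.Relation.Unary.All.Properties as All
open import Data.List.Relation.Unary.Any using (here; there)
open import Data.List.Relation.Unary.Unique.Propositional using (Unique; []; _∷_)
open import Data.List.Relation.Unary.Unique.DecPropositional.Properties using (deduplicate-!)
import Data.List.Relation.Unary.Unique.Propositional.Properties as Unique
open import Data.Nat.Base as ℕ using (ℕ; zero; suc; _!)
import Data.Nat.Properties as ℕ
open import Data.Product.Base using (_×_; _,_; proj₁; proj₂; ∃-syntax)
open import Data.Rational.Base
open import Data.Rational.Properties
open import Algebra.Definitions.RawSemiring +-*-rawSemiring using (_^_)
open import Data.Rational.Solver using (module +-*-Solver)
open import Data.Sum.Base using (inj₁; inj₂)
open import Function.Bundles using (mk⇔; Equivalence)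
open import Relation.Binary.PropositionalEquality
open import Relation.Nullary.Negation.Core using (¬_)
open +-*-Solver using (solve; _:=_; _:+_; _:*_; :-_; _:-_; con)

-- A real logarithm is given only through left Riemann sums, so concavity is never applied to log
-- itself. For fixed `k` the map q ↦ `riemann q k` is increasing, concave and 1-Lipschitz on q ≥ 1,
-- and its derivative lies between 1/q and 1/q + `κ k`; these facts replace all calculus. The
-- discretisation enters the averages as c `κ k`, and since c ≤ n + 1 it costs at most 1 once k ≥ n;
-- this is the origin of the condition k ≥ n. Bounded errors are affordable because the quotient
-- divides them by log log n, which tends to infinity. The second-order term is bounded for the same
-- c: variance over c is at most μ / (1 + μ). Moments and hook sums are computed by induction on the
-- list of variables. The polynomials themselves are defined by enumerating sublists and
-- deduplicated exponent vectors, so a combinatorial part first matches those enumerations with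
-- recursions on the head variable. Most inequalities are closed by exhibiting the difference of the
-- two sides as a visibly nonnegative expression, which leaves a ring identity to the solver.

-- Rational inequalities, reciprocals and finite sums.

≤-from-gap : ∀ {p q d} → 0ℚ ≤ d → q - p ≡ d → p ≤ q
≤-from-gap 0≤d e = ≤-of-sub (subst (0ℚ ≤_) (sym e) 0≤d)

square-nonneg : ∀ p → 0ℚ ≤ p * p
square-nonneg p with ≤-total 0ℚ p
... | inj₁ 0≤p = *-nonneg 0≤p 0≤p
... | inj₂ p≤0 = subst (0ℚ ≤_) (solve 1 (λ p → (:- p) :* (:- p) := p :* p) refl p)
  (*-nonneg (neg-antimono-≤ p≤0) (neg-antimono-≤ p≤0))

*-monoʳ : ∀ {r p q} → 0ℚ ≤ r → p ≤ q → r * p ≤ r * q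
*-monoʳ {r} 0≤r = *-monoˡ-≤-nonNeg r {{nonNegative 0≤r}}

*-monoˡ : ∀ {r p q} → 0ℚ ≤ r → p ≤ q → p * r ≤ q * r
*-monoˡ {r} 0≤r = *-monoʳ-≤-nonNeg r {{nonNegative 0≤r}}

0≤κ : ∀ k → 0ℚ ≤ κ k
0≤κ k = <⇒≤ (0<κ k)

κ≤1 : ∀ k → κ k ≤ 1ℚ
κ≤1 k = κ-anti {0} {k} ℕ.z≤n

ι-suc : ∀ m → ι (suc m) ≡ 1ℚ + ι m
ι-suc m = ι-+ 1 m

1≤ι-suc : ∀ m → 1ℚ ≤ ι (suc m)
1≤ι-suc m = ι-mono {1} {suc m} (ℕ.s≤s ℕ.z≤n)

inv-unique : ∀ p q → p * q ≡ 1ℚ → inv p ≡ q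
inv-unique p q pq≡1 = begin
  inv p             ≡⟨ *-identityʳ (inv p) ⟨
  inv p * 1ℚ        ≡⟨ cong (inv p *_) pq≡1 ⟨
  inv p * (p * q)   ≡⟨ solve 3 (λ i p q → i :* (p :* q) := (p :* i) :* q) refl (inv p) p q ⟩
  (p * inv p) * q   ≡⟨ cong (_* q) (*-inv p p≢0) ⟩
  1ℚ * q            ≡⟨ *-identityˡ q ⟩
  q                 ∎
  where
  open ≡-Reasoning
  p≢0 : p ≢ 0ℚ
  p≢0 refl with trans (sym pq≡1) (*-zeroˡ q)
  ... | ()

inv-ι : ∀ m → inv (ι (suc m)) ≡ κ m
inv-ι m = inv-unique (ι (suc m)) (κ m) (ι-κ m)

0≤inv : ∀ {q} → 0ℚ < q → 0ℚ ≤ inv q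
0≤inv 0<q = <⇒≤ (0<inv 0<q)

inv-sub : ∀ p q → p ≢ 0ℚ → q ≢ 0ℚ → inv p - inv q ≡ (q - p) * (inv p * inv q)
inv-sub p q p≢0 q≢0 = subst₂ _≡_
  (cong₂ _-_ (*-identityˡ (inv p)) (*-identityˡ (inv q)))
  (cong₂ (λ a b → (a - b) * (inv p * inv q)) (*-identityˡ q) (*-identityˡ p))
  (inv-diff p q p≢0 q≢0 1ℚ 1ℚ)

inv-antitone : ∀ {p q} → 0ℚ < p → p ≤ q → inv q ≤ inv p
inv-antitone {p} {q} 0<p p≤q =
  let 0<q = <-≤-trans 0<p p≤q in
  ≤-from-gap (*-nonneg (sub-nonneg p≤q) (*-nonneg (0≤inv 0<p) (0≤inv 0<q)))
    (inv-sub p q (pos≢0 0<p) (pos≢0 0<q))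

∑-head : ∀ n f → ∑ (suc n) f ≡ f 0 + ∑ n (λ i → f (suc i))
∑-head n f = trans (∑-split 1 n f) (cong (_+ ∑ n (λ i → f (suc i))) (+-identityˡ (f 0)))

∑-mono : ∀ n {f g} → (∀ i → f i ≤ g i) → ∑ n f ≤ ∑ n g
∑-mono zero    h = ≤-refl
∑-mono (suc n) h = +-mono-≤ (∑-mono n h) (h n)

∑-nonneg : ∀ n {f} → (∀ i → 0ℚ ≤ f i) → 0ℚ ≤ ∑ n f
∑-nonneg zero    h = ≤-refl
∑-nonneg (suc n) h = +-nonneg (∑-nonneg n h) (h n)

∑-+ : ∀ n f g → ∑ n (λ i → f i + g i) ≡ ∑ n f + ∑ n g
∑-+ zero    f g = refl
∑-+ (suc n) f g = trans (cong (_+ (f n + g n)) (∑-+ n f g))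
  (solve 4 (λ a b c d → (a :+ b) :+ (c :+ d) := (a :+ c) :+ (b :+ d)) refl (∑ n f) (∑ n g) (f n) (g n))

∑-* : ∀ n c f → ∑ n (λ i → c * f i) ≡ c * ∑ n f
∑-* zero    c f = sym (*-zeroʳ c)
∑-* (suc n) c f = trans (cong (_+ c * f n) (∑-* n c f)) (sym (*-distribˡ-+ c (∑ n f) (f n)))

∑-telescope : ∀ n (f : ℕ → ℚ) → ∑ n (λ i → f (suc i) - f i) ≡ f n - f 0
∑-telescope zero    f = sym (+-inverseʳ (f 0))
∑-telescope (suc n) f = trans (cong (_+ (f (suc n) - f n)) (∑-telescope n f))
  (solve 3 (λ a b c → (b :- a) :+ (c :- b) := c :- a) refl (f 0) (f n) (f (suc n)))

-- The Riemann sum as a concave function of its endpoint.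

node weight : ℚ → ℕ → ℕ → ℚ
node q k i = 1ℚ + ι i * logStep q k
weight q k i = inv (node q k i)

module _ {q : ℚ} (1≤q : 1ℚ ≤ q) (k : ℕ) where

  0≤logStep : 0ℚ ≤ logStep q k
  0≤logStep = *-nonneg (sub-nonneg 1≤q) (0≤κ k)

  1≤node : ∀ i → 1ℚ ≤ node q k i
  1≤node i = p≤p+q 1ℚ (*-nonneg (0≤ι i) 0≤logStep)

  0<node : ∀ i → 0ℚ < node q k i
  0<node i = <-≤-trans (positive⁻¹ 1ℚ) (1≤node i)

  node≢0 : ∀ i → node q k i ≢ 0ℚ
  node≢0 i = pos≢0 (0<node i)

  0≤weight : ∀ i → 0ℚ ≤ weight q k i
  0≤weight i = 0≤inv (0<node i)

  weight-antitone : ∀ i → weight q k (suc i) ≤ weight q k i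
  weight-antitone i = inv-antitone (0<node i)
    (+-monoʳ-≤ 1ℚ (*-monoˡ 0≤logStep (ι-mono (ℕ.n≤1+n i))))

-- The left Riemann sum does not evaluate this node; it is the far end of the telescoping in
-- `weight-product-sum`.
node-last : ∀ q k → node q k (suc k) ≡ q
node-last q k = begin
  1ℚ + ι (suc k) * ((q - 1ℚ) * κ k)
    ≡⟨ solve 3 (λ q n κ → con 1ℚ :+ n :* ((q :- con 1ℚ) :* κ) := con 1ℚ :+ (q :- con 1ℚ) :* (n :* κ)) refl q (ι (suc k)) (κ k) ⟩
  1ℚ + (q - 1ℚ) * (ι (suc k) * κ k)
    ≡⟨ cong (λ z → 1ℚ + (q - 1ℚ) * z) (ι-κ k) ⟩
  1ℚ + (q - 1ℚ) * 1ℚ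
    ≡⟨ solve 1 (λ q → con 1ℚ :+ (q :- con 1ℚ) :* con 1ℚ := q) refl q ⟩
  q ∎
  where open ≡-Reasoning

-- The derivative of `riemann q k` in `q`: h / (1 + i h) has derivative 1 / (1 + i h)², and h = (q -
-- 1) `κ k`.
slope : ℚ → ℕ → ℚ
slope q k = κ k * ∑ (suc k) (λ i → weight q k i * weight q k i)

-- h ↦ h / (1 + i h) is concave, so each term of the Riemann sum lies below its tangent.
riemann-tangent : ∀ {p q} → 1ℚ ≤ p → 1ℚ ≤ q → ∀ k → riemann p k - riemann q k ≤ (p - q) * slope q k
riemann-tangent {p} {q} 1≤p 1≤q k = subst₂ _≤_
  (trans (∑-+ (suc k) _ _) (cong (riemann p k +_) (∑-neg (suc k) _)))
  (trans (∑-* (suc k) d _) (*-assoc (p - q) (κ k) _))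
  (∑-mono (suc k) λ i → ≤-from-gap (gap-nonneg i) (gap i))
  where
  open ≡-Reasoning
  d : ℚ
  d = (p - q) * κ k
  u v : ℕ → ℚ
  u = weight p k
  v = weight q k
  ∑-neg : ∀ n f → ∑ n (λ i → - f i) ≡ - ∑ n f
  ∑-neg zero    f = refl
  ∑-neg (suc n) f = trans (cong (_- f n) (∑-neg n f)) (sym (neg-distrib-+ (∑ n f) (f n)))
  gap-nonneg : ∀ i → 0ℚ ≤ ι i * (d * d) * (v i * (v i * u i))
  gap-nonneg i = *-nonneg (*-nonneg (0≤ι i) (square-nonneg d))
    (*-nonneg (0≤weight 1≤q k i) (*-nonneg (0≤weight 1≤q k i) (0≤weight 1≤p k i)))
  gap : ∀ i → d * (v i * v i) - (logStep p k * u i - logStep q k * v i) ≡ ι i * (d * d) * (v i * (v i * u i))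
  gap i = begin
    d * (v i * v i) - (logStep p k * u i - logStep q k * v i)
      ≡⟨ cong (λ z → d * (v i * v i) - z) (inv-diff (node p k i) (node q k i) (node≢0 1≤p k i) (node≢0 1≤q k i) (logStep p k) (logStep q k)) ⟩
    d * (v i * v i) - (logStep p k * node q k i - logStep q k * node p k i) * (u i * v i)
      ≡⟨ solve 6 (λ p q κ i u v →
           (p :- q) :* κ :* (v :* v) :- ((p :- con 1ℚ) :* κ :* (con 1ℚ :+ i :* ((q :- con 1ℚ) :* κ))
             :- (q :- con 1ℚ) :* κ :* (con 1ℚ :+ i :* ((p :- con 1ℚ) :* κ))) :* (u :* v)
           := (p :- q) :* κ :* v :* (v :- u)) refl p q (κ k) (ι i) (u i) (v i) ⟩
    d * v i * (v i - u i)
      ≡⟨ cong (d * v i *_) (inv-sub (node q k i) (node p k i) (node≢0 1≤q k i) (node≢0 1≤p k i)) ⟩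
    d * v i * ((node p k i - node q k i) * (v i * u i))
      ≡⟨ solve 6 (λ p q κ i u v →
           (p :- q) :* κ :* v :* (((con 1ℚ :+ i :* ((p :- con 1ℚ) :* κ)) :- (con 1ℚ :+ i :* ((q :- con 1ℚ) :* κ))) :* (v :* u))
           := i :* ((p :- q) :* κ :* ((p :- q) :* κ)) :* (v :* (v :* u))) refl p q (κ k) (ι i) (u i) (v i) ⟩
    ι i * (d * d) * (v i * (v i * u i)) ∎

module _ {q : ℚ} (1≤q : 1ℚ ≤ q) (k : ℕ) where

  private
    v : ℕ → ℚ
    v = weight q k

  -- The products of consecutive weights telescope along i ↦ i vᵢ.
  weight-product-sum : κ k * ∑ (suc k) (λ i → v i * v (suc i)) ≡ inv q
  weight-product-sum = begin
    κ k * ∑ (suc k) (λ i → v i * v (suc i))             ≡⟨ cong (κ k *_) (∑-cong (suc k) step) ⟩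
    κ k * ∑ (suc k) (λ i → ι (suc i) * v (suc i) - ι i * v i)
                                                        ≡⟨ cong (κ k *_) (∑-telescope (suc k) (λ i → ι i * v i)) ⟩
    κ k * (ι (suc k) * v (suc k) - 0ℚ * v 0)
      ≡⟨ solve 4 (λ κ n v w → κ :* (n :* v :- con 0ℚ :* w) := (n :* κ) :* v) refl (κ k) (ι (suc k)) (v (suc k)) (v 0) ⟩
    (ι (suc k) * κ k) * v (suc k)                       ≡⟨ cong₂ (λ a b → a * inv b) (ι-κ k) (node-last q k) ⟩
    1ℚ * inv q                                          ≡⟨ *-identityˡ (inv q) ⟩
    inv q                                               ∎
    where
    open ≡-Reasoning
    step : ∀ i → v i * v (suc i) ≡ ι (suc i) * v (suc i) - ι i * v i
    step i = sym (trans
      (inv-diff (node q k (suc i)) (node q k i) (node≢0 1≤q k (suc i)) (node≢0 1≤q k i) (ι (suc i)) (ι i))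
      (trans (cong (λ z → (z * node q k i - ι i * (1ℚ + z * logStep q k)) * (v (suc i) * v i)) (ι-suc i))
        (solve 4 (λ i h a b → ((con 1ℚ :+ i) :* (con 1ℚ :+ i :* h) :- i :* (con 1ℚ :+ (con 1ℚ :+ i) :* h)) :* (b :* a) := a :* b)
          refl (ι i) (logStep q k) (v i) (v (suc i)))))

  -- The weights decrease, so replacing one factor of vᵢ² by vᵢ₊₁ lowers the sum to the telescoping
  -- one.
  inv≤slope : inv q ≤ slope q k
  inv≤slope = subst (_≤ slope q k) weight-product-sum
    (*-monoʳ (0≤κ k) (∑-mono (suc k) λ i → *-monoʳ (0≤weight 1≤q k i) (weight-antitone 1≤q k i)))

  -- Here vᵢ₊₁² ≤ vᵢ vᵢ₊₁, so all squares but the first fit under the telescoping sum; v₀² = 1 is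
  -- left over and costs `κ k`.
  slope≤inv+κ : slope q k ≤ inv q + κ k
  slope≤inv+κ = begin
    κ k * ∑ (suc k) (λ i → v i * v i)
      ≡⟨ cong (κ k *_) (∑-head k (λ i → v i * v i)) ⟩
    κ k * (v 0 * v 0 + ∑ k (λ i → v (suc i) * v (suc i)))
      ≤⟨ *-monoʳ (0≤κ k) (+-mono-≤ (≤-reflexive v₀²≡1)
           (∑-mono k λ i → *-monoˡ (0≤weight 1≤q k (suc i)) (weight-antitone 1≤q k i))) ⟩
    κ k * (1ℚ + ∑ k (λ i → v i * v (suc i)))
      ≤⟨ *-monoʳ (0≤κ k) (+-monoʳ-≤ 1ℚ (p≤p+q (∑ k (λ i → v i * v (suc i))) (*-nonneg (0≤weight 1≤q k k) (0≤weight 1≤q k (suc k))))) ⟩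
    κ k * (1ℚ + ∑ (suc k) (λ i → v i * v (suc i)))
      ≡⟨ solve 2 (λ κ s → κ :* (con 1ℚ :+ s) := κ :* s :+ κ) refl (κ k) (∑ (suc k) (λ i → v i * v (suc i))) ⟩
    κ k * ∑ (suc k) (λ i → v i * v (suc i)) + κ k
      ≡⟨ cong (_+ κ k) weight-product-sum ⟩
    inv q + κ k ∎
    where
    open ≤-Reasoning
    v₀²≡1 : v 0 * v 0 ≡ 1ℚ
    v₀²≡1 = cong (λ z → inv z * inv z) (trans (cong (1ℚ +_) (*-zeroˡ (logStep q k))) (+-identityʳ 1ℚ))

  0≤slope : 0ℚ ≤ slope q k
  0≤slope = ≤-trans (0≤inv (<-≤-trans (positive⁻¹ 1ℚ) 1≤q)) inv≤slope

riemann-mono : ∀ {p q} → 1ℚ ≤ p → p ≤ q → ∀ k → riemann p k ≤ riemann q k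
riemann-mono {p} {q} 1≤p p≤q k =
  let 1≤q = ≤-trans 1≤p p≤q in
  ≤-of-sub (≤-trans
    (subst (0ℚ ≤_) (solve 3 (λ p q s → (q :- p) :* s := :- ((p :- q) :* s)) refl p q (slope q k))
      (*-nonneg (sub-nonneg p≤q) (0≤slope 1≤q k)))
    (subst (- ((p - q) * slope q k) ≤_)
      (solve 2 (λ a b → :- (a :- b) := b :- a) refl (riemann p k) (riemann q k))
      (neg-antimono-≤ (riemann-tangent 1≤p 1≤q k))))

-- On q ≥ 1 every node is at least 1, so c = 1 is allowed in `riemann-lipschitz`, where the constant
-- `inv c * inv c` then computes to 1.
riemann-nonexpansive : ∀ p q k → 1ℚ ≤ p → 1ℚ ≤ q → ∣ riemann p k - riemann q k ∣ ≤ ∣ p - q ∣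
riemann-nonexpansive p q k 1≤p 1≤q = subst (∣ riemann p k - riemann q k ∣ ≤_) (*-identityʳ ∣ p - q ∣)
  (riemann-lipschitz (positive⁻¹ 1ℚ) ≤-refl p q k 1≤p 1≤q)

riemann-1 : ∀ k → riemann 1ℚ k ≡ 0ℚ
riemann-1 k = trans (∑-cong (suc k) λ i → trans (cong (_* weight 1ℚ k i) (*-zeroˡ (κ k))) (*-zeroˡ (weight 1ℚ k i)))
  (trans (∑-const (suc k) 0ℚ) (*-zeroʳ (ι (suc k))))

-- Elementary symmetric weights: mass, mean and second moment.

-- ∑ₘ f(m) eₘ(xs): up to the factor mass xs = ∏ (1 + x), the expectation of f at a sum
-- of independent Bernoulli variables with success probabilities x / (1 + x).
weighted : List ℚ → (ℕ → ℚ) → ℚ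
weighted []       f = f 0
weighted (x ∷ xs) f = weighted xs f + x * weighted xs (λ m → f (suc m))

mass : List ℚ → ℚ
mass xs = product (map (λ x → 1ℚ + x) xs)

mean : List ℚ → ℚ
mean xs = sum (map (λ x → x * inv (1ℚ + x)) xs)

NonNeg : List ℚ → Set
NonNeg = All (0ℚ ≤_)

0<1+ : ∀ {x} → 0ℚ ≤ x → 0ℚ < 1ℚ + x
0<1+ 0≤x = <-≤-trans (positive⁻¹ 1ℚ) (p≤p+q 1ℚ 0≤x)

*-inv-1+ : ∀ {x} → 0ℚ ≤ x → (1ℚ + x) * inv (1ℚ + x) ≡ 1ℚ
*-inv-1+ {x} 0≤x = *-inv (1ℚ + x) (pos≢0 (0<1+ 0≤x))

mass-nonneg : ∀ {xs} → NonNeg xs → 0ℚ ≤ mass xs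
mass-nonneg []          = <⇒≤ (positive⁻¹ 1ℚ)
mass-nonneg (0≤x ∷ 0≤xs) = *-nonneg (<⇒≤ (0<1+ 0≤x)) (mass-nonneg 0≤xs)

mean-nonneg : ∀ {xs} → NonNeg xs → 0ℚ ≤ mean xs
mean-nonneg []          = ≤-refl
mean-nonneg (0≤x ∷ 0≤xs) = +-nonneg (*-nonneg 0≤x (0≤inv (0<1+ 0≤x))) (mean-nonneg 0≤xs)

weighted-cong : ∀ xs {f g} → (∀ m → f m ≡ g m) → weighted xs f ≡ weighted xs g
weighted-cong []       e = e 0
weighted-cong (x ∷ xs) e = cong₂ (λ a b → a + x * b) (weighted-cong xs e) (weighted-cong xs (λ m → e (suc m)))

weighted-mono : ∀ {xs f g} → NonNeg xs → (∀ m → f m ≤ g m) → weighted xs f ≤ weighted xs g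
weighted-mono []           h = h 0
weighted-mono (0≤x ∷ 0≤xs) h =
  +-mono-≤ (weighted-mono 0≤xs h) (*-monoʳ 0≤x (weighted-mono 0≤xs (λ m → h (suc m))))

weighted-+* : ∀ xs f b g → weighted xs (λ m → f m + b * g m) ≡ weighted xs f + b * weighted xs g
weighted-+* []       f b g = refl
weighted-+* (x ∷ xs) f b g = trans
  (cong₂ (λ u v → u + x * v) (weighted-+* xs f b g) (weighted-+* xs (λ m → f (suc m)) b (λ m → g (suc m))))
  (solve 6 (λ x b p q r s → p :+ b :* q :+ x :* (r :+ b :* s) := p :+ x :* r :+ b :* (q :+ x :* s)) refl
    x b (weighted xs f) (weighted xs g) (weighted xs (λ m → f (suc m))) (weighted xs (λ m → g (suc m))))

weighted-const : ∀ xs a → weighted xs (λ _ → a) ≡ mass xs * a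
weighted-const []       a = sym (*-identityˡ a)
weighted-const (x ∷ xs) a = trans (cong (λ z → z + x * z) (weighted-const xs a))
  (solve 3 (λ x p a → p :* a :+ x :* (p :* a) := (con 1ℚ :+ x) :* p :* a) refl x (mass xs) a)

weighted-ι : ∀ {xs} → NonNeg xs → weighted xs ι ≡ mass xs * mean xs
weighted-ι []                       = refl
weighted-ι {x ∷ xs} (0≤x ∷ 0≤xs) = begin
  weighted xs ι + x * weighted xs (λ m → ι (suc m))
    ≡⟨ cong (λ z → weighted xs ι + x * z) shifted ⟩
  weighted xs ι + x * (mass xs * 1ℚ + 1ℚ * weighted xs ι)
    ≡⟨ cong (λ z → z + x * (mass xs * 1ℚ + 1ℚ * z)) (weighted-ι 0≤xs) ⟩
  mass xs * mean xs + x * (mass xs * 1ℚ + 1ℚ * (mass xs * mean xs))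
    ≡⟨ solve 3 (λ x p μ → p :* μ :+ x :* (p :* con 1ℚ :+ con 1ℚ :* (p :* μ)) := p :* (x :* con 1ℚ :+ (con 1ℚ :+ x) :* μ))
         refl x (mass xs) (mean xs) ⟩
  mass xs * (x * 1ℚ + (1ℚ + x) * mean xs)
    -- `inv` is opaque to the solver, so a 1 is traded for (1 + x) · `inv (1ℚ + x)` before the ring
    -- identity; the same trade recurs below.
    ≡⟨ cong (λ z → mass xs * (x * z + (1ℚ + x) * mean xs)) (*-inv-1+ 0≤x) ⟨
  mass xs * (x * ((1ℚ + x) * inv (1ℚ + x)) + (1ℚ + x) * mean xs)
    ≡⟨ solve 4 (λ x p μ i → p :* (x :* ((con 1ℚ :+ x) :* i) :+ (con 1ℚ :+ x) :* μ)
                         := (con 1ℚ :+ x) :* p :* (x :* i :+ μ)) refl x (mass xs) (mean xs) (inv (1ℚ + x)) ⟩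
  mass (x ∷ xs) * mean (x ∷ xs) ∎
  where
  open ≡-Reasoning
  shifted : weighted xs (λ m → ι (suc m)) ≡ mass xs * 1ℚ + 1ℚ * weighted xs ι
  shifted = trans (weighted-cong xs λ m → trans (ι-suc m) (cong (1ℚ +_) (sym (*-identityˡ (ι m)))))
    (trans (weighted-+* xs (λ _ → 1ℚ) 1ℚ ι) (cong (_+ 1ℚ * weighted xs ι) (weighted-const xs 1ℚ)))

square : ℚ → ℚ
square p = p * p

-- The variance of a sum of independent Bernoulli variables is at most its mean.
weighted-square : ∀ {xs} → NonNeg xs → ∀ a →
  weighted xs (λ m → square (ι m + a)) ≤ mass xs * (square (mean xs + a) + mean xs)
weighted-square []                    a = ≤-reflexive
  (solve 1 (λ a → (con 0ℚ :+ a) :* (con 0ℚ :+ a) := con 1ℚ :* ((con 0ℚ :+ a) :* (con 0ℚ :+ a) :+ con 0ℚ)) refl a)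
weighted-square {x ∷ xs} (0≤x ∷ 0≤xs) a = begin
  weighted xs (λ m → square (ι m + a)) + x * weighted xs (λ m → square (ι (suc m) + a))
    -- Success of the head variable shifts the index by one. The offset `a` absorbs the shift, which
    -- is why the induction runs over all `a`.
    ≡⟨ cong (λ z → weighted xs (λ m → square (ι m + a)) + x * z) (weighted-cong xs λ m → cong square (shift m)) ⟩
  weighted xs (λ m → square (ι m + a)) + x * weighted xs (λ m → square (ι m + (1ℚ + a)))
    ≤⟨ +-mono-≤ (weighted-square 0≤xs a) (*-monoʳ 0≤x (weighted-square 0≤xs (1ℚ + a))) ⟩
  p * (square (μ + a) + μ) + x * (p * (square (μ + (1ℚ + a)) + μ))
    -- For one variable with parameter x / (1 + x), the mean exceeds the variance by (x / (1 + x))².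
    -- Times the mass (1 + x) p this is the gap p x² / (1 + x).
    ≤⟨ ≤-from-gap (*-nonneg (mass-nonneg 0≤xs) (*-nonneg (square-nonneg x) 0≤i)) gap ⟩
  mass (x ∷ xs) * (square (mean (x ∷ xs) + a) + mean (x ∷ xs)) ∎
  where
  open ≤-Reasoning
  p μ i : ℚ
  p = mass xs
  μ = mean xs
  i = inv (1ℚ + x)
  0≤i : 0ℚ ≤ i
  0≤i = 0≤inv (0<1+ 0≤x)
  shift : ∀ m → ι (suc m) + a ≡ ι m + (1ℚ + a)
  shift m = trans (cong (_+ a) (ι-suc m)) (solve 2 (λ m a → con 1ℚ :+ m :+ a := m :+ (con 1ℚ :+ a)) refl (ι m) a)
  gap : mass (x ∷ xs) * (square (mean (x ∷ xs) + a) + mean (x ∷ xs))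
      - (p * (square (μ + a) + μ) + x * (p * (square (μ + (1ℚ + a)) + μ))) ≡ p * (square x * i)
  gap = trans
    (solve 5 (λ x p μ a i →
        (con 1ℚ :+ x) :* p :* ((x :* i :+ μ :+ a) :* (x :* i :+ μ :+ a) :+ (x :* i :+ μ))
          :- (p :* ((μ :+ a) :* (μ :+ a) :+ μ) :+ x :* (p :* ((μ :+ (con 1ℚ :+ a)) :* (μ :+ (con 1ℚ :+ a)) :+ μ)))
        := ((con 1ℚ :+ x) :* i) :* (p :* (x :* x :* i :+ con (1ℚ + 1ℚ) :* x :* (μ :+ a) :+ x))
           :- p :* (con (1ℚ + 1ℚ) :* x :* (μ :+ a) :+ x)) refl x p μ a i)
    (trans (cong (λ z → z * (p * (square x * i + (1ℚ + 1ℚ) * x * (μ + a) + x)) - p * ((1ℚ + 1ℚ) * x * (μ + a) + x)) (*-inv-1+ 0≤x))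
      (solve 5 (λ x p μ a i →
          con 1ℚ :* (p :* (x :* x :* i :+ con (1ℚ + 1ℚ) :* x :* (μ :+ a) :+ x)) :- p :* (con (1ℚ + 1ℚ) :* x :* (μ :+ a) :+ x)
          := p :* (x :* x :* i)) refl x p μ a i))

-- Hook sums: one variable carries the exponent `r`.

^-nonneg : ∀ {x} → 0ℚ ≤ x → ∀ s → 0ℚ ≤ x ^ s
^-nonneg 0≤x zero    = <⇒≤ (positive⁻¹ 1ℚ)
^-nonneg 0≤x (suc s) = *-nonneg 0≤x (^-nonneg 0≤x s)

module _ (r : ℕ) where

  -- ∑ₗ f(l) m_{[r,1ˡ]}(xs)
  hookWeighted : List ℚ → (ℕ → ℚ) → ℚ
  hookWeighted []       f = 0ℚ
  hookWeighted (x ∷ xs) f = x ^ r * weighted xs f + (hookWeighted xs f + x * hookWeighted xs (λ l → f (suc l)))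

  -- At the reciprocals this is Sᵣ(n). The divisor 1 + x is the factor that the carrier of `r` no
  -- longer contributes to the mass.
  tilt : List ℚ → ℚ
  tilt xs = sum (map (λ x → x ^ r * inv (1ℚ + x)) xs)

  tilt-nonneg : ∀ {xs} → NonNeg xs → 0ℚ ≤ tilt xs
  tilt-nonneg []           = ≤-refl
  tilt-nonneg (0≤x ∷ 0≤xs) = +-nonneg (*-nonneg (^-nonneg 0≤x r) (0≤inv (0<1+ 0≤x))) (tilt-nonneg 0≤xs)

  -- Taking the carrier out of the Bernoulli sum can only lower that sum. For nondecreasing f the
  -- average over the other variables is thus at most the full average.
  hookWeighted-≤ : ∀ {xs f} → NonNeg xs → (∀ m → f m ≤ f (suc m)) → hookWeighted xs f ≤ tilt xs * weighted xs f
  hookWeighted-≤ {f = f} [] mono = ≤-reflexive (sym (*-zeroˡ (f 0)))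
  hookWeighted-≤ {x ∷ xs} {f} (0≤x ∷ 0≤xs) mono = begin
    x ^ r * A + (hookWeighted xs f + x * hookWeighted xs f′)
      ≤⟨ +-monoʳ-≤ (x ^ r * A) (+-mono-≤ (hookWeighted-≤ 0≤xs mono) (*-monoʳ 0≤x (hookWeighted-≤ 0≤xs (λ m → mono (suc m))))) ⟩
    x ^ r * A + (S * A + x * (S * A′))
      ≤⟨ ≤-from-gap (*-nonneg (*-nonneg (^-nonneg 0≤x r) 0≤i) (*-nonneg 0≤x (sub-nonneg (weighted-mono 0≤xs mono)))) gap ⟩
    (x ^ r * i + S) * (A + x * A′) ∎
    where
    open ≤-Reasoning
    f′ : ℕ → ℚ
    f′ m = f (suc m)
    A A′ S i : ℚ
    A  = weighted xs f
    A′ = weighted xs f′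
    S  = tilt xs
    i  = inv (1ℚ + x)
    0≤i : 0ℚ ≤ i
    0≤i = 0≤inv (0<1+ 0≤x)
    gap : (x ^ r * i + S) * (A + x * A′) - (x ^ r * A + (S * A + x * (S * A′))) ≡ x ^ r * i * (x * (A′ - A))
    gap = trans (cong (λ z → (x ^ r * i + S) * (A + x * A′) - (z + (S * A + x * (S * A′))))
        (trans (sym (*-identityʳ (x ^ r * A))) (cong (x ^ r * A *_) (sym (*-inv-1+ 0≤x)))))
      (solve 6 (λ x y i S A A′ → (y :* i :+ S) :* (A :+ x :* A′) :- (y :* A :* ((con 1ℚ :+ x) :* i) :+ (S :* A :+ x :* (S :* A′)))
        := y :* i :* (x :* (A′ :- A))) refl x (x ^ r) i S A A′)

  -- Taking the carrier out lowers the Bernoulli sum by at most one, hence the average of f by at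
  -- most 1, which is `mass xs` before normalisation.
  hookWeighted-≥ : ∀ {xs f} → NonNeg xs → (∀ m → f (suc m) ≤ f m + 1ℚ) →
                   tilt xs * (weighted xs f - mass xs) ≤ hookWeighted xs f
  hookWeighted-≥ {f = f} [] incr = ≤-reflexive (*-zeroˡ (f 0 - 1ℚ))
  hookWeighted-≥ {x ∷ xs} {f} (0≤x ∷ 0≤xs) incr = begin
    (x ^ r * i + S) * (A + x * A′ - (1ℚ + x) * p)
      ≤⟨ ≤-from-gap (*-nonneg (*-nonneg (^-nonneg 0≤x r) 0≤i) (+-nonneg (mass-nonneg 0≤xs) (*-nonneg 0≤x (sub-nonneg A′≤)))) gap ⟩
    x ^ r * A + (S * (A - p) + x * (S * (A′ - p)))
      ≤⟨ +-monoʳ-≤ (x ^ r * A) (+-mono-≤ (hookWeighted-≥ 0≤xs incr) (*-monoʳ 0≤x (hookWeighted-≥ 0≤xs (λ m → incr (suc m))))) ⟩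
    x ^ r * A + (hookWeighted xs f + x * hookWeighted xs f′) ∎
    where
    open ≤-Reasoning
    f′ : ℕ → ℚ
    f′ m = f (suc m)
    A A′ S i p : ℚ
    A  = weighted xs f
    A′ = weighted xs f′
    S  = tilt xs
    i  = inv (1ℚ + x)
    p  = mass xs
    0≤i : 0ℚ ≤ i
    0≤i = 0≤inv (0<1+ 0≤x)
    A′≤ : A′ ≤ A + p
    A′≤ = ≤-trans (weighted-mono 0≤xs incr) (≤-reflexive (trans
      (weighted-+* xs f 1ℚ (λ _ → 1ℚ))
      (cong (A +_) (trans (*-identityˡ _) (trans (weighted-const xs 1ℚ) (*-identityʳ p))))))
    gap : x ^ r * A + (S * (A - p) + x * (S * (A′ - p))) - (x ^ r * i + S) * (A + x * A′ - (1ℚ + x) * p)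
        ≡ x ^ r * i * (p + x * (A + p - A′))
    gap = trans (cong (λ z → z + (S * (A - p) + x * (S * (A′ - p))) - (x ^ r * i + S) * (A + x * A′ - (1ℚ + x) * p))
        (trans (sym (*-identityʳ (x ^ r * A))) (cong (x ^ r * A *_) (sym (*-inv-1+ 0≤x)))))
      (solve 7 (λ x y i S A A′ p → y :* A :* ((con 1ℚ :+ x) :* i) :+ (S :* (A :- p) :+ x :* (S :* (A′ :- p)))
          :- (y :* i :+ S) :* (A :+ x :* A′ :- (con 1ℚ :+ x) :* p)
        := y :* i :* (p :+ x :* (A :+ p :- A′))) refl x (x ^ r) i S A A′ p)

-- The logarithm averaged against the weights.

p-q≤r⇒p≤q+r : ∀ {p q r} → p - q ≤ r → p ≤ q + r
p-q≤r⇒p≤q+r {p} {q} {r} h = ≤-from-gap (sub-nonneg h)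
  (solve 3 (λ p q r → q :+ r :- p := r :- (p :- q)) refl p q r)

∣p-q∣≤r⇒p≤q+r : ∀ p q {r} → ∣ p - q ∣ ≤ r → p ≤ q + r
∣p-q∣≤r⇒p≤q+r p q h = p-q≤r⇒p≤q+r (≤-trans (p≤∣p∣ (p - q)) h)

∣p-q∣≤r⇒q≤p+r : ∀ p q {r} → ∣ p - q ∣ ≤ r → q ≤ p + r
∣p-q∣≤r⇒q≤p+r p q {r} h = ∣p-q∣≤r⇒p≤q+r q p (subst (_≤ r) (∣p-q∣≡∣q-p∣ p q) h)

∣-∣-bounds : ∀ {p q r} → p ≤ q + r → q ≤ p + r → ∣ p - q ∣ ≤ r
∣-∣-bounds {p} {q} {r} a b = ∣p∣≤
  (≤-from-gap (sub-nonneg a) (solve 3 (λ p q r → r :- (p :- q) := q :+ r :- p) refl p q r))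
  (≤-from-gap (sub-nonneg b) (solve 3 (λ p q r → r :- (:- (p :- q)) := p :+ r :- q) refl p q r))

-- Definitionally the `k`-th approximant of `logℕ (suc m)`, so that index m pairs log (m + 1) with
-- eₘ as in `A₁`.
log-approx : ℕ → ℕ → ℚ
log-approx k m = riemann (ι (suc m)) k

log-approx-≤-+ : ∀ k m s → log-approx k (m ℕ.+ s) ≤ log-approx k m + ι s
log-approx-≤-+ k m s = ∣p-q∣≤r⇒p≤q+r (log-approx k (m ℕ.+ s)) (log-approx k m)
  (≤-trans (riemann-nonexpansive (ι (suc (m ℕ.+ s))) (ι (suc m)) k (1≤ι-suc (m ℕ.+ s)) (1≤ι-suc m))
    (≤-reflexive (trans (cong ∣_∣ (trans (cong (_- ι (suc m)) (ι-+ (suc m) s))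
        (solve 2 (λ a b → a :+ b :- a := b) refl (ι (suc m)) (ι s))))
      (0≤p⇒∣p∣≡p (0≤ι s)))))

log-approx-mono : ∀ k {m n} → m ℕ.≤ n → log-approx k m ≤ log-approx k n
log-approx-mono k {m} m≤n = riemann-mono (1≤ι-suc m) (ι-mono (ℕ.s≤s m≤n)) k

module _ {xs : List ℚ} (0≤xs : NonNeg xs) (k : ℕ) where

  private
    μ c : ℚ
    μ = mean xs
    c = 1ℚ + μ
    0<c : 0ℚ < c
    0<c = 0<1+ (mean-nonneg 0≤xs)
    1≤c : 1ℚ ≤ c
    1≤c = p≤p+q 1ℚ (mean-nonneg 0≤xs)
    ic : ℚ
    ic = inv c
    0≤ic : 0ℚ ≤ ic
    0≤ic = 0≤inv 0<c
    p : ℚ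
    p = mass xs

  -- Jensen's inequality. The tangent at c = 1 + μ is affine in m, and m + 1 has mean c, so the
  -- tangent averages to its value at c.
  weighted-log-≤ : weighted xs (log-approx k) ≤ mass xs * riemann (1ℚ + mean xs) k
  weighted-log-≤ = begin
    weighted xs (log-approx k)                   ≤⟨ weighted-mono 0≤xs pointwise ⟩
    weighted xs (λ m → α + s * ι m)              ≡⟨ weighted-+* xs (λ _ → α) s ι ⟩
    weighted xs (λ _ → α) + s * weighted xs ι    ≡⟨ cong₂ (λ a b → a + s * b) (weighted-const xs α) (weighted-ι 0≤xs) ⟩
    p * α + s * (p * μ)
      ≡⟨ solve 4 (λ p R s μ → p :* (R :- s :* μ) :+ s :* (p :* μ) := p :* R) refl p (riemann c k) s μ ⟩
    p * riemann c k ∎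
    where
    open ≤-Reasoning
    s α : ℚ
    s = slope c k
    α = riemann c k - s * μ
    pointwise : ∀ m → log-approx k m ≤ α + s * ι m
    pointwise m = ≤-trans (p-q≤r⇒p≤q+r {q = riemann c k} (riemann-tangent (1≤ι-suc m) 1≤c k))
      (≤-reflexive (trans (cong (λ z → riemann c k + (z - c) * s) (ι-suc m))
        (solve 4 (λ R m μ s → R :+ (con 1ℚ :+ m :- (con 1ℚ :+ μ)) :* s := R :- s :* μ :+ s :* m)
          refl (riemann c k) (ι m) μ s)))

  -- With y = m + 1, the tangent at y gives log y ≥ log c − (c/y − 1), and
  -- c/y − 1 ≤ − (y − c)/c + (y − c)²/c as y ≥ 1.
  log-approx-≥ : ∀ m → riemann c k - c * κ k + ic * (ι m - μ) ≤ log-approx k m + ic * square (ι m - μ)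
  log-approx-≥ m = ≤-from-gap
    -- The sign of c - y is not fixed, so (c - y) s is split: c s uses s ≤ 1/y + `κ k`, and y s uses
    -- s ≥ 1/y. The last summand spends 1/y ≤ 1 on the quadratic term.
    (+-nonneg (sub-nonneg (p-q≤r⇒p≤q+r {q = log-approx k m} (riemann-tangent 1≤c (1≤ι-suc m) k)))
      (+-nonneg (+-nonneg (*-nonneg (<⇒≤ 0<c) (sub-nonneg s≤)) (*-nonneg (0≤ι (suc m)) (sub-nonneg ≤s)))
        (*-nonneg (*-nonneg 0≤ic (square-nonneg (ι m - μ))) (sub-nonneg (κ≤1 m)))))
    gap
    where
    open ≡-Reasoning
    g s i y : ℚ
    g = log-approx k m
    s = slope (ι (suc m)) k
    i = κ m
    y = ι (suc m)
    ≤s : i ≤ s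
    ≤s = subst (_≤ s) (inv-ι m) (inv≤slope (1≤ι-suc m) k)
    s≤ : s ≤ i + κ k
    s≤ = subst (λ z → s ≤ z + κ k) (inv-ι m) (slope≤inv+κ (1≤ι-suc m) k)
    base sum-of-gaps : ℚ → ℚ
    base d = (g + ic * square d) - (riemann c k - c * κ k + ic * d)
    sum-of-gaps d = (g + (c - y) * s - riemann c k) + ((c * (i + κ k - s) + y * (s - i)) + ic * square d * (1ℚ - i))
    -- The solver sees `ic` and `i` as free variables; the added correction vanishes because c ·
    -- `ic` = 1 and y · `i` = 1.
    expand : base (y - c) + (y - c) * (i * (c * ic - 1ℚ) + ic * (1ℚ - y * i)) ≡ sum-of-gaps (y - c)
    expand = solve 8 (λ g c y s R i κ j →
        (g :+ j :* ((y :- c) :* (y :- c))) :- (R :- c :* κ :+ j :* (y :- c))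
          :+ (y :- c) :* (i :* (c :* j :- con 1ℚ) :+ j :* (con 1ℚ :- y :* i))
        := (g :+ (c :- y) :* s :- R) :+ ((c :* (i :+ κ :- s) :+ y :* (s :- i)) :+ j :* ((y :- c) :* (y :- c)) :* (con 1ℚ :- i)))
      refl g c y s (riemann c k) i (κ k) ic
    y-c : ι m - μ ≡ y - c
    y-c = trans (solve 2 (λ m μ → m :- μ := con 1ℚ :+ m :- (con 1ℚ :+ μ)) refl (ι m) μ) (cong (_- c) (sym (ι-suc m)))
    gap : base (ι m - μ) ≡ sum-of-gaps (ι m - μ)
    gap = begin
      base (ι m - μ)
        ≡⟨ cong base y-c ⟩
      base (y - c)
        ≡⟨ solve 4 (λ z d i j → z := z :+ d :* (i :* (con 1ℚ :- con 1ℚ) :+ j :* (con 1ℚ :- con 1ℚ))) refl (base (y - c)) (y - c) i ic ⟩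
      base (y - c) + (y - c) * (i * (1ℚ - 1ℚ) + ic * (1ℚ - 1ℚ))
        ≡⟨ cong₂ (λ a b → base (y - c) + (y - c) * (i * (a - 1ℚ) + ic * (1ℚ - b))) (*-inv c (pos≢0 0<c)) (ι-κ m) ⟨
      base (y - c) + (y - c) * (i * (c * ic - 1ℚ) + ic * (1ℚ - y * i))
        ≡⟨ expand ⟩
      sum-of-gaps (y - c)
        ≡⟨ cong sum-of-gaps y-c ⟨
      sum-of-gaps (ι m - μ) ∎

  -- In the average of `log-approx-≥` the linear term drops out. The quadratic one is the variance
  -- over c, at most μ / (1 + μ), whence the final 1.
  weighted-log-≥ : mass xs * (riemann (1ℚ + mean xs) k - (1ℚ + mean xs) * κ k - 1ℚ) ≤ weighted xs (log-approx k)
  weighted-log-≥ = begin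
    p * (riemann c k - c * κ k - 1ℚ)
      ≡⟨ cong (λ z → p * (riemann c k - c * κ k - z)) (*-inv c (pos≢0 0<c)) ⟨
    p * (riemann c k - c * κ k - c * ic)
      ≤⟨ ≤-from-gap (*-nonneg (mass-nonneg 0≤xs) 0≤ic)
           (solve 4 (λ p β μ j → p :* β :- j :* (p :* μ) :- p :* (β :- (con 1ℚ :+ μ) :* j) := p :* j)
             refl p (riemann c k - c * κ k) μ ic) ⟩
    p * (riemann c k - c * κ k) - ic * (p * μ)
      ≤⟨ ≤-from-gap (sub-nonneg moments)
           (solve 3 (λ w b e → w :- (b :- e) := w :+ e :- b) refl (weighted xs (log-approx k)) (p * (riemann c k - c * κ k)) (ic * (p * μ))) ⟩
    weighted xs (log-approx k) ∎
    where
    open ≤-Reasoning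
    α : ℚ
    α = riemann c k - c * κ k - ic * μ
    moments : p * (riemann c k - c * κ k) ≤ weighted xs (log-approx k) + ic * (p * μ)
    moments = begin
      p * (riemann c k - c * κ k)
        ≡⟨ solve 4 (λ p β μ j → p :* β := p :* (β :- j :* μ) :+ j :* (p :* μ)) refl p (riemann c k - c * κ k) μ ic ⟩
      p * α + ic * (p * μ)
        ≡⟨ cong₂ (λ a b → a + ic * b) (weighted-const xs α) (weighted-ι 0≤xs) ⟨
      weighted xs (λ _ → α) + ic * weighted xs ι
        ≡⟨ weighted-+* xs (λ _ → α) ic ι ⟨
      weighted xs (λ m → α + ic * ι m)
        ≤⟨ weighted-mono 0≤xs (λ m → subst (_≤ log-approx k m + ic * square (ι m - μ))
             (solve 4 (λ β j m μ → β :+ j :* (m :- μ) := β :- j :* μ :+ j :* m) refl (riemann c k - c * κ k) ic (ι m) μ)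
             (log-approx-≥ m)) ⟩
      weighted xs (λ m → log-approx k m + ic * square (ι m - μ))
        ≡⟨ weighted-+* xs (log-approx k) ic (λ m → square (ι m - μ)) ⟩
      weighted xs (log-approx k) + ic * weighted xs (λ m → square (ι m - μ))
        ≤⟨ +-monoʳ-≤ (weighted xs (log-approx k)) (*-monoʳ 0≤ic (weighted-square 0≤xs (- μ))) ⟩
      weighted xs (log-approx k) + ic * (p * (square (μ - μ) + μ))
        ≡⟨ solve 4 (λ w j p μ → w :+ j :* (p :* ((μ :- μ) :* (μ :- μ) :+ μ)) := w :+ j :* (p :* μ)) refl (weighted xs (log-approx k)) ic p μ ⟩
      weighted xs (log-approx k) + ic * (p * μ) ∎

  module _ {X : ℚ} (cκ≤1 : (1ℚ + mean xs) * κ k ≤ 1ℚ) (near : ∣ riemann (1ℚ + mean xs) k - X ∣ ≤ ι 2) where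

    weighted-log-upper : weighted xs (log-approx k) ≤ mass xs * (X + ι 2)
    weighted-log-upper = ≤-trans weighted-log-≤ (*-monoʳ (mass-nonneg 0≤xs) (∣p-q∣≤r⇒p≤q+r (riemann c k) X near))

    -- The losses are 1 for the variance, 1 for c `κ k`, and 2 for the distance to `X`.
    weighted-log-lower : mass xs * (X - ι 4) ≤ weighted xs (log-approx k)
    weighted-log-lower = ≤-trans
      (*-monoʳ (mass-nonneg 0≤xs) (≤-from-gap (+-nonneg (sub-nonneg cκ≤1) (sub-nonneg (∣p-q∣≤r⇒q≤p+r (riemann c k) X near)))
        (solve 3 (λ R X e → R :- e :- con 1ℚ :- (X :- con (ι 4)) := (con 1ℚ :- e) :+ (R :+ con (ι 2) :- X)) refl (riemann c k) X (c * κ k))))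
      weighted-log-≥

    -- The factors `1ℚ` stand where the hook sums have their tilt, so that one limit argument serves
    -- both.
    weighted-log-near : ∣ weighted xs (log-approx k) - 1ℚ * (mass xs * X) ∣ ≤ 1ℚ * (mass xs * ι 5)
    weighted-log-near = ∣-∣-bounds
      (≤-trans weighted-log-upper (≤-from-gap (*-nonneg (mass-nonneg 0≤xs) (0≤ι 3))
        (solve 2 (λ p X → con 1ℚ :* (p :* X) :+ con 1ℚ :* (p :* con (ι 5)) :- p :* (X :+ con (ι 2)) := p :* con (ι 3)) refl p X)))
      (≤-from-gap (+-nonneg (sub-nonneg weighted-log-lower) (mass-nonneg 0≤xs))
        (solve 3 (λ w p X → w :+ con 1ℚ :* (p :* con (ι 5)) :- con 1ℚ :* (p :* X) := w :- p :* (X :- con (ι 4)) :+ p)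
          refl (weighted xs (log-approx k)) p X))

    -- Below, monotonicity discards the shift by `r`, and removing the carrier costs 1 on top of 4.
    -- Above, the shift costs at most `r` on top of 2. Both fit into 5 + r.
    hookWeighted-log-near : ∀ r →
      ∣ hookWeighted r xs (λ l → log-approx k (l ℕ.+ r)) - tilt r xs * (mass xs * X) ∣ ≤ tilt r xs * (mass xs * ι (5 ℕ.+ r))
    hookWeighted-log-near r = ∣-∣-bounds
      (≤-trans (hookWeighted-≤ r 0≤xs (λ m → log-approx-mono k (ℕ.n≤1+n (m ℕ.+ r))))
        (≤-trans (*-monoʳ 0≤S upper) (≤-from-gap (*-nonneg 0≤S (*-nonneg (mass-nonneg 0≤xs) (0≤ι 3)))
          (trans (cong (λ z → S * (p * X) + S * (p * z) - S * (p * (X + ι 2) + ι r * p)) (ι-+ 5 r))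
            (solve 4 (λ S p X r → S :* (p :* X) :+ S :* (p :* (con (ι 5) :+ r)) :- S :* (p :* (X :+ con (ι 2)) :+ r :* p)
              := S :* (p :* con (ι 3))) refl S p X (ι r))))))
      (≤-from-gap (+-nonneg (sub-nonneg (≤-trans (*-monoʳ 0≤S (+-monoˡ-≤ (- p) lower)) (hookWeighted-≥ r 0≤xs increment)))
                            (*-nonneg 0≤S (*-nonneg (mass-nonneg 0≤xs) (0≤ι r))))
        (trans (cong (λ z → V + S * (p * z) - S * (p * X)) (ι-+ 5 r))
          (solve 5 (λ V S p X r → V :+ S :* (p :* (con (ι 5) :+ r)) :- S :* (p :* X)
            := V :- S :* (p :* (X :- con (ι 4)) :- p) :+ S :* (p :* r)) refl V S p X (ι r))))
      where
      open ≤-Reasoning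
      f : ℕ → ℚ
      f l = log-approx k (l ℕ.+ r)
      S V : ℚ
      S = tilt r xs
      V = hookWeighted r xs f
      0≤S : 0ℚ ≤ S
      0≤S = tilt-nonneg r 0≤xs
      increment : ∀ m → f (suc m) ≤ f m + 1ℚ
      increment m = subst (λ z → log-approx k z ≤ f m + 1ℚ) (ℕ.+-comm (m ℕ.+ r) 1) (log-approx-≤-+ k (m ℕ.+ r) 1)
      lower : p * (X - ι 4) ≤ weighted xs f
      lower = ≤-trans weighted-log-lower (weighted-mono 0≤xs (λ m → log-approx-mono k (ℕ.m≤m+n m r)))
      upper : weighted xs f ≤ p * (X + ι 2) + ι r * p
      upper = begin
        weighted xs f
          ≤⟨ weighted-mono 0≤xs (λ m → subst (λ z → f m ≤ log-approx k m + z) (sym (*-identityʳ (ι r))) (log-approx-≤-+ k m r)) ⟩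
        weighted xs (λ m → log-approx k m + ι r * 1ℚ)
          ≡⟨ weighted-+* xs (log-approx k) (ι r) (λ _ → 1ℚ) ⟩
        weighted xs (log-approx k) + ι r * weighted xs (λ _ → 1ℚ)
          ≡⟨ cong (λ z → weighted xs (log-approx k) + ι r * z) (trans (weighted-const xs 1ℚ) (*-identityʳ p)) ⟩
        weighted xs (log-approx k) + ι r * p
          ≤⟨ +-monoˡ-≤ (ι r * p) weighted-log-upper ⟩
        p * (X + ι 2) + ι r * p ∎

-- Exponent vectors of hook shape.

∈-replicate⁻ : ∀ {A : Set} {x y : A} n → x ∈ replicate n y → ∃[ m ] (n ≡ suc m × x ≡ y)
∈-replicate⁻ (suc n) (here x≡y) = n , refl , x≡y
∈-replicate⁻ (suc n) (there x∈) = n , refl , proj₂ (proj₂ (∈-replicate⁻ n x∈))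

insertions-↭ : ∀ {A : Set} (x : A) ys {α} → α ∈ insertions x ys → α ↭ x ∷ ys
insertions-↭ x []       (here refl) = ↭-refl
insertions-↭ x (y ∷ ys) (here refl) = ↭-refl
insertions-↭ x (y ∷ ys) (there α∈) with β , β∈ , refl ← ∈-map⁻ (y ∷_) α∈ =
  ↭-trans (prep y (insertions-↭ x ys β∈)) (swap y x ↭-refl)

∈-insertions : ∀ {A : Set} (x : A) ys zs → ys ++ x ∷ zs ∈ insertions x (ys ++ zs)
∈-insertions x []       []       = here refl
∈-insertions x []       (z ∷ zs) = here refl
∈-insertions x (y ∷ ys) zs       = there (∈-map⁺ (y ∷_) (∈-insertions x ys zs))

permutations-↭ : ∀ {A : Set} (xs : List A) {α} → α ∈ permutations xs → α ↭ xs
permutations-↭ []       (here refl) = ↭-refl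
permutations-↭ (x ∷ xs) α∈ with β , β∈ , α∈β ← find (∈-concatMap⁻ (insertions x) α∈) =
  ↭-trans (insertions-↭ x β α∈β) (prep x (permutations-↭ xs β∈))

↭-permutations : ∀ {A : Set} (xs : List A) {α} → α ↭ xs → α ∈ permutations xs
↭-permutations []       α↭ with refl ← Perm.↭-empty-inv α↭ = here refl
↭-permutations (x ∷ xs) α↭ with ys , zs , refl ← ∈-∃++ (Perm.∈-resp-↭ (↭-sym α↭) (here refl)) =
  ∈-concatMap⁺ (insertions x) (lose (↭-permutations xs (Perm.drop-mid ys [] α↭)) (∈-insertions x ys zs))

consOne : (ℕ → List (List ℕ)) → ℕ → List (List ℕ)
consOne V zero    = []
consOne V (suc l) = map (1 ∷_) (V l)

∈-consOne⁻ : ∀ V l {α} → α ∈ consOne V l → ∃[ m ] ∃[ β ] (l ≡ suc m × β ∈ V m × α ≡ 1 ∷ β)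
∈-consOne⁻ V (suc l) α∈ with β , β∈ , α≡ ← ∈-map⁻ (1 ∷_) α∈ = l , β , refl , β∈ , α≡

consOne-! : ∀ V l → (∀ m → Unique (V m)) → Unique (consOne V l)
consOne-! V zero    V! = []
consOne-! V (suc l) V! = Unique.map⁺ List.∷-injectiveʳ (V! l)

consOne-head≢ : ∀ {a} V l {L α} → 1 ≢ a → α ∈ consOne V l → ¬ α ∈ map (a ∷_) L
consOne-head≢ {a} V l 1≢a α∈ α∈′ with _ , _ , _ , _ , refl ← ∈-consOne⁻ V l α∈ | _ , _ , eq ← ∈-map⁻ (a ∷_) α∈′ =
  1≢a (List.∷-injectiveˡ eq)

-- The 0-1 vectors of length n with l ones, sorted by first entry to match the recursion for
-- elementary symmetric polynomials.
binary : ℕ → ℕ → List (List ℕ)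
binary zero    zero    = [] ∷ []
binary zero    (suc l) = []
binary (suc n) l       = consOne (binary n) l ++ map (0 ∷_) (binary n l)

binary-! : ∀ n l → Unique (binary n l)
binary-! zero    zero    = [] ∷ []
binary-! zero    (suc l) = []
binary-! (suc n) l       = Unique.++⁺ (consOne-! (binary n) l (binary-! n)) (Unique.map⁺ List.∷-injectiveʳ (binary-! n l))
  λ (α∈ , α∈′) → consOne-head≢ (binary n) l (λ ()) α∈ α∈′

shift-zero : ∀ p z → p ++ replicate (suc z) 0 ↭ 0 ∷ p ++ replicate z 0
shift-zero p z = Perm.shift 0 p (replicate z 0)

binary-sound : ∀ n l {α} → α ∈ binary n l → ∃[ z ] (n ≡ l ℕ.+ z × α ↭ replicate l 1 ++ replicate z 0)
binary-sound zero    zero    (here refl) = 0 , refl , ↭-refl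
binary-sound (suc n) l       α∈ with ∈-++⁻ (consOne (binary n) l) α∈
... | inj₁ α∈ with m , β , refl , β∈ , refl ← ∈-consOne⁻ (binary n) l α∈
      with z , n≡ , β↭ ← binary-sound n m β∈ =
  z , cong suc n≡ , prep 1 β↭
... | inj₂ α∈ with β , β∈ , refl ← ∈-map⁻ (0 ∷_) α∈
      with z , n≡ , β↭ ← binary-sound n l β∈ =
  suc z , trans (cong suc n≡) (sym (ℕ.+-suc l z)) , ↭-trans (prep 0 β↭) (↭-sym (shift-zero (replicate l 1) z))

binary-complete : ∀ n l z {α} → n ≡ l ℕ.+ z → α ↭ replicate l 1 ++ replicate z 0 → α ∈ binary n l
binary-complete zero    zero    zero  n≡ α↭ with refl ← Perm.↭-empty-inv α↭ = here refl
binary-complete (suc n) l z {[]} n≡ α↭ with () ← trans n≡ (trans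
    (sym (trans (List.length-++ (replicate l 1)) (cong₂ ℕ._+_ (List.length-replicate l) (List.length-replicate z))))
    (Perm.↭-length (↭-sym α↭)))
binary-complete (suc n) l z {a ∷ α} n≡ α↭ with ∈-++⁻ (replicate l 1) (Perm.∈-resp-↭ α↭ (here refl))
... | inj₁ a∈ with m , refl , refl ← ∈-replicate⁻ l a∈ =
  ∈-++⁺ˡ (∈-map⁺ (1 ∷_) (binary-complete n m z (ℕ.suc-injective n≡) (Perm.drop-∷ α↭)))
... | inj₂ a∈ with m , refl , refl ← ∈-replicate⁻ z a∈ =
  ∈-++⁺ʳ (consOne (binary n) l) (∈-map⁺ (0 ∷_)
    (binary-complete n l m (ℕ.suc-injective (trans n≡ (ℕ.+-suc l m)))
      (Perm.drop-∷ (↭-trans α↭ (shift-zero (replicate l 1) m)))))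

module _ (r : ℕ) where

  -- The rearrangements of (r, 1ˡ, 0, ..., 0) of length n. The blocks with first entry r, 1 and 0
  -- correspond to the three summands of `hookWeighted`.
  hooks : ℕ → ℕ → List (List ℕ)
  hooks zero    l = []
  hooks (suc n) l = map (r ∷_) (binary n l) ++ (consOne (hooks n) l ++ map (0 ∷_) (hooks n l))

  -- The three blocks are told apart by their first entries; r ≥ 2 makes r different from 1 and 0.
  hooks-! : 2 ℕ.≤ r → ∀ n l → Unique (hooks n l)
  hooks-! 2≤r zero    l = []
  hooks-! 2≤r (suc n) l = Unique.++⁺ (Unique.map⁺ List.∷-injectiveʳ (binary-! n l))
    (Unique.++⁺ (consOne-! (hooks n) l (hooks-! 2≤r n)) (Unique.map⁺ List.∷-injectiveʳ (hooks-! 2≤r n l))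
      λ (α∈ , α∈′) → consOne-head≢ (hooks n) l (λ ()) α∈ α∈′)
    disjoint
    where
    disjoint : ∀ {α} → ¬ (α ∈ map (r ∷_) (binary n l) × α ∈ consOne (hooks n) l ++ map (0 ∷_) (hooks n l))
    disjoint (α∈ , α∈′) with ∈-++⁻ (consOne (hooks n) l) α∈′
    ... | inj₁ α∈″ = consOne-head≢ (hooks n) l (ℕ.<⇒≢ 2≤r) α∈″ α∈
    ... | inj₂ α∈″ with _ , _ , refl ← ∈-map⁻ (r ∷_) α∈ | _ , _ , eq ← ∈-map⁻ (0 ∷_) α∈″ =
      ℕ.m<n⇒n≢0 2≤r (List.∷-injectiveˡ eq)

  hooks-sound : ∀ n l {α} → α ∈ hooks n l → ∃[ z ] (n ≡ suc (l ℕ.+ z) × α ↭ r ∷ replicate l 1 ++ replicate z 0)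
  hooks-sound (suc n) l α∈ with ∈-++⁻ (map (r ∷_) (binary n l)) α∈
  ... | inj₁ α∈ with β , β∈ , refl ← ∈-map⁻ (r ∷_) α∈
      with z , n≡ , β↭ ← binary-sound n l β∈ =
    z , cong suc n≡ , prep r β↭
  ... | inj₂ α∈ with ∈-++⁻ (consOne (hooks n) l) α∈
  ...   | inj₁ α∈ with m , β , refl , β∈ , refl ← ∈-consOne⁻ (hooks n) l α∈
      with z , n≡ , β↭ ← hooks-sound n m β∈ =
    z , cong suc n≡ , ↭-trans (prep 1 β↭) (swap 1 r ↭-refl)
  ...   | inj₂ α∈ with β , β∈ , refl ← ∈-map⁻ (0 ∷_) α∈
      with z , n≡ , β↭ ← hooks-sound n l β∈ =
    suc z , cong suc (trans n≡ (sym (ℕ.+-suc l z))) , ↭-trans (prep 0 β↭) (↭-sym (shift-zero (r ∷ replicate l 1) z))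

  hooks-complete : ∀ n l z {α} → n ≡ suc (l ℕ.+ z) → α ↭ r ∷ replicate l 1 ++ replicate z 0 → α ∈ hooks n l
  hooks-complete (suc n) l z {[]}    n≡ α↭ with () ← Perm.↭-length α↭
  hooks-complete (suc n) l z {a ∷ α} n≡ α↭ with Perm.∈-resp-↭ α↭ (here refl)
  ... | here refl = ∈-++⁺ˡ (∈-map⁺ (r ∷_) (binary-complete n l z (ℕ.suc-injective n≡) (Perm.drop-∷ α↭)))
  ... | there a∈ with ∈-++⁻ (replicate l 1) a∈
  ...   | inj₁ a∈ with m , refl , refl ← ∈-replicate⁻ l a∈ =
    ∈-++⁺ʳ (map (r ∷_) (binary n l)) (∈-++⁺ˡ (∈-map⁺ (1 ∷_)
      (hooks-complete n m z (ℕ.suc-injective n≡) (Perm.drop-∷ (↭-trans α↭ (swap r 1 ↭-refl))))))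
  ...   | inj₂ a∈ with m , refl , refl ← ∈-replicate⁻ z a∈ =
    ∈-++⁺ʳ (map (r ∷_) (binary n l)) (∈-++⁺ʳ (consOne (hooks n) l) (∈-map⁺ (0 ∷_)
      (hooks-complete n l m (trans (ℕ.suc-injective n≡) (ℕ.+-suc l m))
        (Perm.drop-∷ (↭-trans α↭ (shift-zero (r ∷ replicate l 1) m))))))

  -- `deduplicate` is never unfolded: both lists are free of repetitions and have the same members,
  -- so they agree up to order, which a sum ignores.
  exponents-↭-hooks : 2 ℕ.≤ r → ∀ n l → l ℕ.< n → exponents (r ∷ replicate l 1) n ↭ hooks n l
  exponents-↭-hooks 2≤r n l l<n = ↭-trans (↭-reflexive exponents≡)
    (∼bag⇒↭ (unique∧set⇒bag (deduplicate-! (List.≡-dec ℕ._≟_) (permutations p)) (hooks-! 2≤r n l) (mk⇔ to from)))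
    where
    z : ℕ
    z = n ℕ.∸ suc l
    p : List ℕ
    p = r ∷ replicate l 1 ++ replicate z 0
    n≡ : n ≡ suc (l ℕ.+ z)
    n≡ = sym (ℕ.m+[n∸m]≡n l<n)
    exponents≡ : exponents (r ∷ replicate l 1) n ≡ deduplicate (List.≡-dec ℕ._≟_) (permutations p)
    exponents≡ rewrite List.length-replicate l {1} | Equivalence.to T-≡ (ℕ.≤⇒≤ᵇ l<n) = refl
    to : ∀ {α} → α ∈ deduplicate (List.≡-dec ℕ._≟_) (permutations p) → α ∈ hooks n l
    to α∈ = hooks-complete n l z n≡ (permutations-↭ p (∈-deduplicate⁻ (List.≡-dec ℕ._≟_) (permutations p) α∈))
    from : ∀ {α} → α ∈ hooks n l → α ∈ deduplicate (List.≡-dec ℕ._≟_) (permutations p)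
    from α∈ with z′ , n≡′ , α↭ ← hooks-sound n l α∈
      -- The length fixes the number of zeros, so the `z′` found by `hooks-sound` is `z`.
      with refl ← ℕ.+-cancelˡ-≡ l z z′ (ℕ.suc-injective (trans (sym n≡) n≡′)) =
      ∈-deduplicate⁺ (List.≡-dec ℕ._≟_) (↭-permutations p α↭)

-- From symmetric polynomials to the recursive weighted sums.

sum-++ : ∀ xs ys → sum (xs ++ ys) ≡ sum xs + sum ys
sum-++ []       ys = sym (+-identityˡ (sum ys))
sum-++ (x ∷ xs) ys = trans (cong (x +_) (sum-++ xs ys)) (sym (+-assoc x (sum xs) (sum ys)))

sum-↭ : ∀ {xs ys} → xs ↭ ys → sum xs ≡ sum ys
sum-↭ ↭.refl = refl
sum-↭ (prep x p) = cong (x +_) (sum-↭ p)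
sum-↭ {_ ∷ _ ∷ xs} {_ ∷ _ ∷ ys} (swap x y p) = trans (cong (λ z → x + (y + z)) (sum-↭ p))
  (solve 3 (λ x y s → x :+ (y :+ s) := y :+ (x :+ s)) refl x y (sum ys))
sum-↭ (↭.trans p q) = trans (sum-↭ p) (sum-↭ q)

sum-map-++ : ∀ {A : Set} (φ : A → ℚ) xs ys → sum (map φ (xs ++ ys)) ≡ sum (map φ xs) + sum (map φ ys)
sum-map-++ φ xs ys = trans (cong sum (List.map-++ φ xs ys)) (sum-++ (map φ xs) (map φ ys))

sum-map-map : ∀ {A B : Set} (φ : B → ℚ) (ψ : A → ℚ) h c → (∀ a → φ (h a) ≡ c * ψ a) →
              ∀ xs → sum (map φ (map h xs)) ≡ c * sum (map ψ xs)
sum-map-map φ ψ h c e []       = sym (*-zeroʳ c)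
sum-map-map φ ψ h c e (x ∷ xs) = trans (cong₂ _+_ (e x) (sum-map-map φ ψ h c e xs)) (sym (*-distribˡ-+ c (ψ x) (sum (map ψ xs))))

-- The coefficients of a generating function after multiplication by its variable; the value 0 at
-- index 0 lets the recursions hold for all m at once.
delayed : (ℕ → ℚ) → ℕ → ℚ
delayed u zero    = 0ℚ
delayed u (suc m) = u m

elementary-∷ : ∀ m x xs → elementary m (x ∷ xs) ≡ x * delayed (λ j → elementary j xs) m + elementary m xs
elementary-∷ zero    x xs = sym (trans (cong (_+ elementary 0 xs) (*-zeroʳ x)) (+-identityˡ (elementary 0 xs)))
elementary-∷ (suc m) x xs = trans (sum-map-++ product (map (x ∷_) (choose m xs)) (choose (suc m) xs))
  (cong (_+ elementary (suc m) xs) (sum-map-map product product (x ∷_) x (λ _ → refl) (choose m xs)))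

monomial : List ℚ → List ℕ → ℚ
monomial xs α = product (zipWith _^_ xs α)

sum-consOne : ∀ x xs V m →
  sum (map (monomial (x ∷ xs)) (consOne V m)) ≡ x * delayed (λ j → sum (map (monomial xs) (V j))) m
sum-consOne x xs V zero    = sym (*-zeroʳ x)
sum-consOne x xs V (suc m) =
  sum-map-map (monomial (x ∷ xs)) (monomial xs) (1 ∷_) x (λ α → cong (_* monomial xs α) (*-identityʳ x)) (V m)

sum-consZero : ∀ x xs L → sum (map (monomial (x ∷ xs)) (map (0 ∷_) L)) ≡ sum (map (monomial xs) L)
sum-consZero x xs L = trans (sum-map-map (monomial (x ∷ xs)) (monomial xs) (0 ∷_) 1ℚ (λ _ → refl) L) (*-identityˡ _)

delayed-cong : ∀ {u v} → (∀ j → u j ≡ v j) → ∀ m → delayed u m ≡ delayed v m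
delayed-cong e zero    = refl
delayed-cong e (suc m) = e m

sum-binary : ∀ xs m → sum (map (monomial xs) (binary (length xs) m)) ≡ elementary m xs
sum-binary []       zero    = refl
sum-binary []       (suc m) = refl
sum-binary (x ∷ xs) m = begin
  sum (map (monomial (x ∷ xs)) (consOne V m ++ map (0 ∷_) (V m)))
    ≡⟨ sum-map-++ (monomial (x ∷ xs)) (consOne V m) (map (0 ∷_) (V m)) ⟩
  sum (map (monomial (x ∷ xs)) (consOne V m)) + sum (map (monomial (x ∷ xs)) (map (0 ∷_) (V m)))
    ≡⟨ cong₂ _+_ (sum-consOne x xs V m) (sum-consZero x xs (V m)) ⟩
  x * delayed (λ j → sum (map (monomial xs) (V j))) m + sum (map (monomial xs) (V m))
    ≡⟨ cong₂ (λ a b → x * a + b) (delayed-cong (sum-binary xs) m) (sum-binary xs m) ⟩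
  x * delayed (λ j → elementary j xs) m + elementary m xs
    ≡⟨ elementary-∷ m x xs ⟨
  elementary m (x ∷ xs) ∎
  where
  open ≡-Reasoning
  V : ℕ → List (List ℕ)
  V = binary (length xs)

hookSum : ℕ → List ℚ → ℕ → ℚ
hookSum r xs l = sum (map (monomial xs) (hooks r (length xs) l))

hookSum-∷ : ∀ r x xs l → hookSum r (x ∷ xs) l ≡ x ^ r * elementary l xs + (x * delayed (hookSum r xs) l + hookSum r xs l)
hookSum-∷ r x xs l = begin
  sum (map φ (map (r ∷_) U ++ (consOne V l ++ map (0 ∷_) (V l))))
    ≡⟨ sum-map-++ φ (map (r ∷_) U) (consOne V l ++ map (0 ∷_) (V l)) ⟩
  sum (map φ (map (r ∷_) U)) + sum (map φ (consOne V l ++ map (0 ∷_) (V l)))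
    ≡⟨ cong₂ _+_ (trans (sum-map-map φ (monomial xs) (r ∷_) (x ^ r) (λ _ → refl) U) (cong (x ^ r *_) (sum-binary xs l)))
         (trans (sum-map-++ φ (consOne V l) (map (0 ∷_) (V l))) (cong₂ _+_ (sum-consOne x xs V l) (sum-consZero x xs (V l)))) ⟩
  x ^ r * elementary l xs + (x * delayed (hookSum r xs) l + hookSum r xs l) ∎
  where
  open ≡-Reasoning
  φ : List ℕ → ℚ
  φ = monomial (x ∷ xs)
  U : List (List ℕ)
  U = binary (length xs) l
  V : ℕ → List (List ℕ)
  V = hooks r (length xs)

∑-delayed : ∀ n (f u : ℕ → ℚ) → ∑ (suc n) (λ m → f m * delayed u m) ≡ ∑ n (λ m → f (suc m) * u m)
∑-delayed n f u = trans (∑-head n (λ m → f m * delayed u m))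
  (trans (cong (_+ ∑ n (λ m → f (suc m) * u m)) (*-zeroʳ (f 0))) (+-identityˡ _))

-- Allowing any n ≥ `length xs` gives the induction room: the tail is used with `suc n` against `f`
-- and with `n` against the shifted `f`.
∑-elementary : ∀ xs n f → length xs ℕ.≤ n → ∑ (suc n) (λ m → f m * elementary m xs) ≡ weighted xs f
∑-elementary [] n f _ = begin
  ∑ (suc n) (λ m → f m * elementary m [])                     ≡⟨ ∑-head n (λ m → f m * elementary m []) ⟩
  f 0 * 1ℚ + ∑ n (λ m → f (suc m) * 0ℚ)                       ≡⟨ cong₂ _+_ (*-identityʳ (f 0)) (∑-cong n λ m → *-zeroʳ (f (suc m))) ⟩
  f 0 + ∑ n (λ _ → 0ℚ)                                        ≡⟨ cong (f 0 +_) (trans (∑-const n 0ℚ) (*-zeroʳ (ι n))) ⟩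
  f 0 + 0ℚ                                                    ≡⟨ +-identityʳ (f 0) ⟩
  f 0                                                         ∎
  where open ≡-Reasoning
∑-elementary (x ∷ xs) (suc n) f (ℕ.s≤s ≤n) = begin
  ∑ (2 ℕ.+ n) (λ m → f m * elementary m (x ∷ xs))
    ≡⟨ ∑-cong (2 ℕ.+ n) (λ m → trans (cong (f m *_) (elementary-∷ m x xs))
         (solve 4 (λ f x d e → f :* (x :* d :+ e) := f :* e :+ x :* (f :* d)) refl (f m) x (delayed e m) (e m))) ⟩
  ∑ (2 ℕ.+ n) (λ m → f m * e m + x * (f m * delayed e m))
    ≡⟨ ∑-+ (2 ℕ.+ n) (λ m → f m * e m) (λ m → x * (f m * delayed e m)) ⟩
  ∑ (2 ℕ.+ n) (λ m → f m * e m) + ∑ (2 ℕ.+ n) (λ m → x * (f m * delayed e m))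
    ≡⟨ cong₂ _+_ (∑-elementary xs (suc n) f (ℕ.m≤n⇒m≤1+n ≤n))
         (trans (∑-* (2 ℕ.+ n) x (λ m → f m * delayed e m))
           (cong (x *_) (trans (∑-delayed (suc n) f e) (∑-elementary xs n (λ m → f (suc m)) ≤n)))) ⟩
  weighted (x ∷ xs) f ∎
  where
  open ≡-Reasoning
  e : ℕ → ℚ
  e j = elementary j xs

∑-hookSum : ∀ r xs n f → length xs ℕ.≤ n → ∑ n (λ l → f l * hookSum r xs l) ≡ hookWeighted r xs f
∑-hookSum r [] n f _ = trans (∑-cong n λ l → *-zeroʳ (f l)) (trans (∑-const n 0ℚ) (*-zeroʳ (ι n)))
∑-hookSum r (x ∷ xs) (suc n) f (ℕ.s≤s ≤n) = begin
  ∑ (suc n) (λ l → f l * hookSum r (x ∷ xs) l)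
    ≡⟨ ∑-cong (suc n) (λ l → trans (cong (f l *_) (hookSum-∷ r x xs l))
         (solve 6 (λ f y e x d h → f :* (y :* e :+ (x :* d :+ h)) := y :* (f :* e) :+ (f :* h :+ x :* (f :* d)))
           refl (f l) (x ^ r) (e l) x (delayed h l) (h l))) ⟩
  ∑ (suc n) (λ l → x ^ r * (f l * e l) + (f l * h l + x * (f l * delayed h l)))
    ≡⟨ trans (∑-+ (suc n) (λ l → x ^ r * (f l * e l)) (λ l → f l * h l + x * (f l * delayed h l)))
         (cong₂ _+_ (∑-* (suc n) (x ^ r) (λ l → f l * e l))
           (trans (∑-+ (suc n) (λ l → f l * h l) (λ l → x * (f l * delayed h l)))
             (cong (∑ (suc n) (λ l → f l * h l) +_) (∑-* (suc n) x (λ l → f l * delayed h l))))) ⟩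
  x ^ r * ∑ (suc n) (λ l → f l * e l) + (∑ (suc n) (λ l → f l * h l) + x * ∑ (suc n) (λ l → f l * delayed h l))
    ≡⟨ cong₂ (λ a b → x ^ r * a + b) (∑-elementary xs n f ≤n)
         (cong₂ (λ a b → a + x * b) (∑-hookSum r xs (suc n) f (ℕ.m≤n⇒m≤1+n ≤n))
           (trans (∑-delayed n f h) (∑-hookSum r xs n (λ l → f (suc l)) ≤n))) ⟩
  hookWeighted r (x ∷ xs) f ∎
  where
  open ≡-Reasoning
  e h : ℕ → ℚ
  e j = elementary j xs
  h   = hookSum r xs

monomialSymmetric-hook : ∀ r → 2 ℕ.≤ r → ∀ xs l → l ℕ.< length xs →
                         monomialSymmetric (r ∷ replicate l 1) xs ≡ hookSum r xs l
monomialSymmetric-hook r 2≤r xs l l< = sum-↭ (Perm.map⁺ (monomial xs) (exponents-↭-hooks r 2≤r (length xs) l l<))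

-- The reciprocals: mass, mean and harmonic sums.

∑-cong-< : ∀ n {f g} → (∀ i → i ℕ.< n → f i ≡ g i) → ∑ n f ≡ ∑ n g
∑-cong-< zero    e = refl
∑-cong-< (suc n) e = cong₂ _+_ (∑-cong-< n λ i i<n → e i (ℕ.m≤n⇒m≤1+n i<n)) (e n ℕ.≤-refl)

∑-≤-+ : ∀ m d {f} → (∀ i → 0ℚ ≤ f i) → ∑ m f ≤ ∑ (m ℕ.+ d) f
∑-≤-+ m d {f} 0≤f = subst (∑ m f ≤_) (sym (∑-split m d f)) (p≤p+q (∑ m f) (∑-nonneg d λ i → 0≤f (m ℕ.+ i)))

∑-monoˡ : ∀ {m n f} → (∀ i → 0ℚ ≤ f i) → m ℕ.≤ n → ∑ m f ≤ ∑ n f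
∑-monoˡ {m} {n} {f} 0≤f m≤n = subst (λ z → ∑ m f ≤ ∑ z f) (ℕ.m+[n∸m]≡n m≤n) (∑-≤-+ m (n ℕ.∸ m) 0≤f)

sum-applyUpTo : ∀ f n → sum (applyUpTo f n) ≡ ∑ n f
sum-applyUpTo f zero    = refl
sum-applyUpTo f (suc n) = trans (cong (λ z → f 0 + z) (sum-applyUpTo (λ i → f (suc i)) n)) (sym (∑-head n f))

product-applyUpTo : ∀ f n → product (applyUpTo f (suc n)) ≡ product (applyUpTo f n) * f n
product-applyUpTo f zero    = *-comm (f 0) 1ℚ
product-applyUpTo f (suc n) = trans (cong (f 0 *_) (product-applyUpTo (λ i → f (suc i)) n))
  (sym (*-assoc (f 0) (product (applyUpTo (λ i → f (suc i)) n)) (f (suc n))))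

map-reciprocals : ∀ (φ : ℚ → ℚ) n → map φ (reciprocals n) ≡ applyUpTo (λ i → φ (κ i)) n
map-reciprocals φ n = trans (cong (map φ) (List.map-upTo κ n)) (List.map-applyUpTo κ φ n)

sum-reciprocals : ∀ (φ : ℚ → ℚ) n → sum (map φ (reciprocals n)) ≡ ∑ n (λ i → φ (κ i))
sum-reciprocals φ n = trans (cong sum (map-reciprocals φ n)) (sum-applyUpTo (λ i → φ (κ i)) n)

length-reciprocals : ∀ n → length (reciprocals n) ≡ n
length-reciprocals n = trans (List.length-map κ (upTo n)) (List.length-upTo n)

reciprocals-nonneg : ∀ n → NonNeg (reciprocals n)
reciprocals-nonneg n = subst NonNeg (sym (List.map-upTo κ n)) (All.applyUpTo⁺₂ κ n 0≤κ)

mass-reciprocals : ∀ n → mass (reciprocals n) ≡ ι (suc n)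
mass-reciprocals n = trans (cong product (map-reciprocals (λ x → 1ℚ + x) n)) (telescope n)
  where
  telescope : ∀ n → product (applyUpTo (λ i → 1ℚ + κ i) n) ≡ ι (suc n)
  telescope zero    = refl
  telescope (suc n) = begin
    product (applyUpTo (λ i → 1ℚ + κ i) (suc n))         ≡⟨ product-applyUpTo (λ i → 1ℚ + κ i) n ⟩
    product (applyUpTo (λ i → 1ℚ + κ i) n) * (1ℚ + κ n)  ≡⟨ cong (_* (1ℚ + κ n)) (telescope n) ⟩
    ι (suc n) * (1ℚ + κ n)                               ≡⟨ solve 2 (λ n κ → n :* (con 1ℚ :+ κ) := n :* κ :+ n) refl (ι (suc n)) (κ n) ⟩
    ι (suc n) * κ n + ι (suc n)                          ≡⟨ cong (_+ ι (suc n)) (ι-κ n) ⟩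
    1ℚ + ι (suc n)                                       ≡⟨ ι-suc (suc n) ⟨
    ι (2 ℕ.+ n)                                          ∎
    where open ≡-Reasoning

inv-1+κ : ∀ i → inv (1ℚ + κ i) ≡ ι (suc i) * κ (suc i)
inv-1+κ i = inv-unique (1ℚ + κ i) (ι (suc i) * κ (suc i)) (begin
  (1ℚ + κ i) * (ι (suc i) * κ (suc i))
    ≡⟨ solve 3 (λ κ n κ′ → (con 1ℚ :+ κ) :* (n :* κ′) := (n :* κ :+ n) :* κ′) refl (κ i) (ι (suc i)) (κ (suc i)) ⟩
  (ι (suc i) * κ i + ι (suc i)) * κ (suc i)
    ≡⟨ cong (λ z → (z + ι (suc i)) * κ (suc i)) (ι-κ i) ⟩
  (1ℚ + ι (suc i)) * κ (suc i)
    ≡⟨ cong (_* κ (suc i)) (ι-suc (suc i)) ⟨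
  ι (2 ℕ.+ i) * κ (suc i)
    ≡⟨ ι-κ (suc i) ⟩
  1ℚ ∎)
  where open ≡-Reasoning

κ-inv-1+κ : ∀ i → κ i * inv (1ℚ + κ i) ≡ κ (suc i)
κ-inv-1+κ i = trans (cong (κ i *_) (inv-1+κ i))
  (trans (solve 3 (λ κ n κ′ → κ :* (n :* κ′) := (n :* κ) :* κ′) refl (κ i) (ι (suc i)) (κ (suc i)))
    (trans (cong (_* κ (suc i)) (ι-κ i)) (*-identityˡ (κ (suc i)))))

-- The term 1 is left out: this is Hₙ₊₁ − 1.
harmonic : ℕ → ℚ
harmonic n = ∑ n (λ i → κ (suc i))

mean-reciprocals : ∀ n → mean (reciprocals n) ≡ harmonic n
mean-reciprocals n = trans (sum-reciprocals (λ x → x * inv (1ℚ + x)) n) (∑-cong n κ-inv-1+κ)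

0≤harmonic : ∀ n → 0ℚ ≤ harmonic n
0≤harmonic n = ∑-nonneg n λ i → 0≤κ (suc i)

-- Crude, but it bounds the discretisation error c `κ k` by 1 as soon as k ≥ n.
harmonic-≤ : ∀ n → 1ℚ + harmonic n ≤ ι (suc n)
harmonic-≤ n = subst (1ℚ + harmonic n ≤_) (sym (ι-suc n)) (+-monoʳ-≤ 1ℚ
  (≤-trans (∑-mono n λ i → κ≤1 (suc i)) (≤-reflexive (trans (∑-const n 1ℚ) (*-identityʳ (ι n))))))

-- Oresme's argument: each of the next n + 2 terms is at least 1 / (2 (n + 2)), so together they add
-- at least ½.
harmonic-block : ∀ n → harmonic n + κ 1 ≤ harmonic (n ℕ.+ (2 ℕ.+ n))
harmonic-block n = subst (harmonic n + κ 1 ≤_) (sym (∑-split n (2 ℕ.+ n) (λ i → κ (suc i))))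
  (+-monoʳ-≤ (harmonic n) (begin
    κ 1                                                 ≡⟨ κ-refine 1 (suc n) ⟨
    ι (2 ℕ.+ n) * κ b                                   ≡⟨ ∑-const (2 ℕ.+ n) (κ b) ⟨
    ∑ (2 ℕ.+ n) (λ _ → κ b)                             ≤⟨ termwise (2 ℕ.+ n) ℕ.≤-refl ⟩
    ∑ (2 ℕ.+ n) (λ i → κ (suc (n ℕ.+ i)))               ∎))
  where
  open ≤-Reasoning
  b : ℕ
  -- This is 2 n + 3, in the shape that `κ-refine 1 (suc n)` produces.
  b = suc n ℕ.+ 1 ℕ.* suc (suc n)
  termwise : ∀ m → m ℕ.≤ 2 ℕ.+ n → ∑ m (λ _ → κ b) ≤ ∑ m (λ i → κ (suc (n ℕ.+ i)))
  termwise zero    _  = ≤-refl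
  termwise (suc m) m≤ = +-mono-≤ (termwise m (ℕ.<⇒≤ m≤))
    (κ-anti {suc (n ℕ.+ m)} {b} (ℕ.s≤s (ℕ.+-monoʳ-≤ n (ℕ.≤-trans (ℕ.<⇒≤ m≤) (ℕ.≤-reflexive (sym (ℕ.*-identityˡ (2 ℕ.+ n))))))))

harmonic-unbounded : ∀ B → ∃[ n ] (ι B ≤ harmonic n)
harmonic-unbounded zero    = 0 , ≤-refl
harmonic-unbounded (suc B) with n , B≤ ← harmonic-unbounded B =
  let m = n ℕ.+ (2 ℕ.+ n) in m ℕ.+ (2 ℕ.+ m) , (begin
    ι (suc B)                       ≡⟨ ι-suc B ⟩
    1ℚ + ι B                        ≤⟨ +-monoʳ-≤ 1ℚ B≤ ⟩
    1ℚ + harmonic n                 ≡⟨ solve 1 (λ h → con 1ℚ :+ h := h :+ con (κ 1) :+ con (κ 1)) refl (harmonic n) ⟩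
    harmonic n + κ 1 + κ 1          ≤⟨ +-monoˡ-≤ (κ 1) (harmonic-block n) ⟩
    harmonic m + κ 1                ≤⟨ harmonic-block m ⟩
    harmonic (m ℕ.+ (2 ℕ.+ m))      ∎)
  where open ≤-Reasoning

-- Logarithm against harmonic sum, and growth of log log n.

-- Each step uses the tangent at its right end m + 2, of slope at least 1 / (m + 2). `inv≤slope` has
-- no error term, so none accumulates.
harmonic-≤-log : ∀ k m → harmonic m ≤ log-approx k m
harmonic-≤-log k zero    = ≤-reflexive (sym (riemann-1 k))
harmonic-≤-log k (suc m) = ≤-trans (+-monoˡ-≤ (κ (suc m)) (harmonic-≤-log k m))
  (≤-from-gap (+-nonneg (sub-nonneg tangent) (sub-nonneg κ≤slope))
    (solve 4 (λ a b s κ → b :- (a :+ κ) := (con (- 1ℚ) :* s :- (a :- b)) :+ (s :- κ)) refl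
      (log-approx k m) (log-approx k (suc m)) s (κ (suc m))))
  where
  s : ℚ
  s = slope (ι (2 ℕ.+ m)) k
  κ≤slope : κ (suc m) ≤ s
  κ≤slope = subst (_≤ s) (inv-ι (suc m)) (inv≤slope (1≤ι-suc (suc m)) k)
  tangent : log-approx k m - log-approx k (suc m) ≤ - 1ℚ * s
  tangent = subst (λ z → log-approx k m - log-approx k (suc m) ≤ z * s)
    (trans (cong (λ z → ι (suc m) - z) (ι-suc (suc m))) (solve 1 (λ n → n :- (con 1ℚ :+ n) := con (- 1ℚ)) refl (ι (suc m))))
    (riemann-tangent (1≤ι-suc m) (1≤ι-suc (suc m)) k)

-- Now the tangent is taken at the left end m + 1, and each step pays the `κ k` of `slope≤inv+κ`.
log-≤-harmonic : ∀ k m → log-approx k m ≤ ∑ m κ + ι m * κ k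
log-≤-harmonic k zero    = ≤-reflexive (trans (riemann-1 k) (sym (trans (+-identityˡ (0ℚ * κ k)) (*-zeroˡ (κ k)))))
log-≤-harmonic k (suc m) = begin
  log-approx k (suc m)                          ≤⟨ p-q≤r⇒p≤q+r {q = log-approx k m} tangent ⟩
  log-approx k m + 1ℚ * s                       ≤⟨ +-mono-≤ (log-≤-harmonic k m) (≤-trans (≤-reflexive (*-identityˡ s)) s≤) ⟩
  (∑ m κ + ι m * κ k) + (κ m + κ k)             ≡⟨ solve 4 (λ h m κ κ′ → h :+ m :* κ :+ (κ′ :+ κ) := h :+ κ′ :+ (con 1ℚ :+ m) :* κ) refl (∑ m κ) (ι m) (κ k) (κ m) ⟩
  ∑ (suc m) κ + (1ℚ + ι m) * κ k                ≡⟨ cong (λ z → ∑ (suc m) κ + z * κ k) (ι-suc m) ⟨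
  ∑ (suc m) κ + ι (suc m) * κ k                 ∎
  where
  open ≤-Reasoning
  s : ℚ
  s = slope (ι (suc m)) k
  s≤ : s ≤ κ m + κ k
  s≤ = subst (λ z → s ≤ z + κ k) (inv-ι m) (slope≤inv+κ (1≤ι-suc m) k)
  tangent : log-approx k (suc m) - log-approx k m ≤ 1ℚ * s
  tangent = subst (λ z → log-approx k (suc m) - log-approx k m ≤ z * s)
    (trans (cong (_- ι (suc m)) (ι-suc (suc m))) (solve 1 (λ n → con 1ℚ :+ n :- n := con 1ℚ) refl (ι (suc m))))
    (riemann-tangent (1≤ι-suc (suc m)) (1≤ι-suc m) k)

ι*κ≤1′ : ∀ {n k} → n ℕ.≤ suc k → ι n * κ k ≤ 1ℚ
ι*κ≤1′ {n} {k} n≤ = subst (ι n * κ k ≤_) (ι-κ k) (*-monoˡ (0≤κ k) (ι-mono n≤))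

-- One direction spends 2 on the leading 1 and on one further harmonic term. In the other, n ≤ k
-- keeps the accumulated error `ι m * κ k` at most 1.
log-near-harmonic : ∀ n .{{_ : ℕ.NonZero n}} k → n ℕ.≤ k → ∣ (1ℚ + harmonic n) - riemann (ι n) k ∣ ≤ ι 2
log-near-harmonic (suc m) k n≤k = ∣-∣-bounds
  (begin
    1ℚ + (harmonic m + κ (suc m))      ≤⟨ +-monoʳ-≤ 1ℚ (+-mono-≤ (harmonic-≤-log k m) (κ≤1 (suc m))) ⟩
    1ℚ + (log-approx k m + 1ℚ)         ≡⟨ solve 1 (λ l → con 1ℚ :+ (l :+ con 1ℚ) := l :+ con (ι 2)) refl (log-approx k m) ⟩
    log-approx k m + ι 2               ∎)
  (begin
    log-approx k m                     ≤⟨ log-≤-harmonic k m ⟩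
    ∑ m κ + ι m * κ k                  ≤⟨ +-mono-≤ (∑-monoˡ 0≤κ (ℕ.n≤1+n m)) (ι*κ≤1′ (ℕ.≤-trans (ℕ.n≤1+n m) (ℕ.m≤n⇒m≤1+n n≤k))) ⟩
    ∑ (suc m) κ + 1ℚ                   ≡⟨ cong (_+ 1ℚ) (∑-head m κ) ⟩
    1ℚ + harmonic m + 1ℚ               ≤⟨ ≤-from-gap (+-nonneg (0≤κ (suc m)) (0≤ι 1))
                                            (solve 2 (λ h κ → con 1ℚ :+ (h :+ κ) :+ con (ι 2) :- (con 1ℚ :+ h :+ con 1ℚ) := κ :+ con (ι 1)) refl (harmonic m) (κ (suc m))) ⟩
    1ℚ + (harmonic m + κ (suc m)) + ι 2 ∎)
  where open ≤-Reasoning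

-- The `k`-th approximant of log log n uses the same k in both logarithms. A bounded distance
-- between Hₙ₊₁ and log n stays bounded since the outer Riemann sum is 1-Lipschitz.
log-log-near : ∀ n .{{_ : ℕ.NonZero n}} k → n ℕ.≤ k → 1ℚ ≤ riemann (ι n) k →
               ∣ riemann (1ℚ + harmonic n) k - riemann (riemann (ι n) k) k ∣ ≤ ι 2
log-log-near n k n≤k 1≤ = ≤-trans
  (riemann-nonexpansive (1ℚ + harmonic n) (riemann (ι n) k) k (p≤p+q 1ℚ (0≤harmonic n)) 1≤)
  (log-near-harmonic n k n≤k)

module _ {B M n : ℕ} .{{_ : ℕ.NonZero n}} {k : ℕ} (n≤k : n ℕ.≤ k)
  (B≤ : ι (2 ℕ.+ B) ≤ harmonic M) (M≤ : ι (2 ℕ.+ M) ≤ harmonic n) where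

  private
    c ℓ : ℚ
    c = 1ℚ + harmonic n
    ℓ = riemann (ι n) k

  log-large : 1ℚ ≤ ℓ
  log-large = ≤-from-gap
    (+-nonneg (sub-nonneg (∣p-q∣≤r⇒p≤q+r c ℓ (log-near-harmonic n k n≤k)))
      (sub-nonneg (≤-trans (ι-mono {2} {2 ℕ.+ M} (ℕ.m≤m+n 2 M)) M≤)))
    (solve 2 (λ l h → l :- con 1ℚ := (l :+ con (ι 2) :- (con 1ℚ :+ h)) :+ (h :- con (ι 2))) refl ℓ (harmonic n))

  log-log-≥ : ι B ≤ riemann ℓ k
  log-log-≥ = ≤-from-gap
    (+-nonneg (sub-nonneg (subst (_≤ harmonic M) (ι-+ 2 B) B≤))
      (+-nonneg (sub-nonneg harmonic≤) (sub-nonneg (∣p-q∣≤r⇒p≤q+r (riemann c k) (riemann ℓ k) (log-log-near n k n≤k log-large)))))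
    (solve 4 (λ b h r x → x :- b := (h :- (con (ι 2) :+ b)) :+ ((r :- h) :+ (x :+ con (ι 2) :- r))) refl
      (ι B) (harmonic M) (riemann c k) (riemann ℓ k))
    where
    M≤c : ι (suc M) ≤ c
    M≤c = ≤-trans (ι-mono (ℕ.n≤1+n (suc M))) (≤-trans M≤
      (subst (_≤ c) (+-identityˡ (harmonic n)) (+-monoˡ-≤ (harmonic n) (0≤ι 1))))
    harmonic≤ : harmonic M ≤ riemann c k
    harmonic≤ = ≤-trans (harmonic-≤-log k M) (riemann-mono (1≤ι-suc M) M≤c k)

-- Divergence of the harmonic sums is used once per logarithm: log (M + 1) is at least B + 2, and
-- Hₙ₊₁ at least M + 1. The 2 added to `B` pays for `log-log-near`; the 2 added to `M` secures log n
-- ≥ 1 even if M = 0.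
log-log-large : ∀ B → ∃[ N ] (∀ n .{{_ : ℕ.NonZero n}} k → N ℕ.≤ n → n ℕ.≤ k →
                1ℚ ≤ riemann (ι n) k × ι B ≤ riemann (riemann (ι n) k) k)
log-log-large B =
  let M , B≤ = harmonic-unbounded (2 ℕ.+ B)
      N , M≤ = harmonic-unbounded (2 ℕ.+ M)
  in N , λ n k N≤n n≤k →
    let M≤n = ≤-trans M≤ (∑-monoˡ (λ i → 0≤κ (suc i)) N≤n)
    in log-large {B} {M} {n} n≤k B≤ M≤n , log-log-≥ {B} {M} {n} n≤k B≤ M≤n

-- The tilt sums Sᵣ(n) and the alternating zeta sum.

tiltTerm : ℕ → ℕ → ℚ
tiltTerm s i = κ i ^ s * inv (1ℚ + κ i)

tiltSum : ℕ → ℕ → ℚ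
tiltSum s n = ∑ n (tiltTerm s)

0≤inv-1+κ : ∀ i → 0ℚ ≤ inv (1ℚ + κ i)
0≤inv-1+κ i = 0≤inv (0<1+ (0≤κ i))

0≤tiltTerm : ∀ s i → 0ℚ ≤ tiltTerm s i
0≤tiltTerm s i = *-nonneg (proj₁ (κ^-bounds i s)) (0≤inv-1+κ i)

tiltTerm-≤ : ∀ t i → tiltTerm (2 ℕ.+ t) i ≤ tiltTerm 2 i
tiltTerm-≤ t i = *-monoˡ (0≤inv-1+κ i) (*-monoʳ (0≤κ i) (*-monoʳ (0≤κ i) (proj₂ (κ^-bounds i t))))

tiltTerm-2 : ∀ i → tiltTerm 2 i ≡ κ i - κ (suc i)
tiltTerm-2 i = begin
  κ i * (κ i * 1ℚ) * inv (1ℚ + κ i)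
    ≡⟨ solve 2 (λ κ j → κ :* (κ :* con 1ℚ) :* j := κ :* j :* κ) refl (κ i) (inv (1ℚ + κ i)) ⟩
  κ i * inv (1ℚ + κ i) * κ i   ≡⟨ cong (_* κ i) (κ-inv-1+κ i) ⟩
  κ (suc i) * κ i              ≡⟨ κ-telescope i ⟩
  κ i - κ (suc i)              ∎
  where open ≡-Reasoning

tiltSum-2 : ∀ n → tiltSum 2 n ≡ 1ℚ - κ n
tiltSum-2 zero    = refl
tiltSum-2 (suc n) = trans (cong₂ _+_ (tiltSum-2 n) (tiltTerm-2 n))
  (solve 2 (λ a b → con 1ℚ :- a :+ (a :- b) := con 1ℚ :- b) refl (κ n) (κ (suc n)))

-- Since x^(s+1) + x^s = x^s (1 + x), the denominator cancels and the recurrence is exact at every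
-- finite n.
tiltSum-suc : ∀ s n → tiltSum (suc s) n ≡ ∑ n (λ i → κ i ^ s) - tiltSum s n
tiltSum-suc s n = begin
  tiltSum (suc s) n
    ≡⟨ solve 2 (λ a b → a := a :+ b :- b) refl (tiltSum (suc s) n) (tiltSum s n) ⟩
  tiltSum (suc s) n + tiltSum s n - tiltSum s n
    ≡⟨ cong (_- tiltSum s n) (trans (sym (∑-+ n (tiltTerm (suc s)) (tiltTerm s))) (∑-cong n step)) ⟩
  ∑ n (λ i → κ i ^ s) - tiltSum s n ∎
  where
  open ≡-Reasoning
  step : ∀ i → tiltTerm (suc s) i + tiltTerm s i ≡ κ i ^ s
  step i = trans (solve 3 (λ κ y j → κ :* y :* j :+ y :* j := y :* ((con 1ℚ :+ κ) :* j)) refl (κ i) (κ i ^ s) (inv (1ℚ + κ i)))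
    (trans (cong (κ i ^ s *_) (*-inv-1+ (0≤κ i))) (*-identityʳ (κ i ^ s)))

tiltSum-≤1 : ∀ {r} → 2 ℕ.≤ r → ∀ n → tiltSum r n ≤ 1ℚ
tiltSum-≤1 {suc (suc t)} (ℕ.s≤s (ℕ.s≤s _)) n = ≤-trans (∑-mono n (tiltTerm-≤ t)) (≤-trans (≤-reflexive (tiltSum-2 n))
  (≤-from-gap (0≤κ n) (solve 1 (λ κ → con 1ℚ :- (con 1ℚ :- κ) := κ) refl (κ n))))

-- Terms with a higher exponent are dominated by those with exponent 2, whose tail telescopes to
-- `κ n - κ (n ℕ.+ d)`.
tiltSum-tail : ∀ t n d → ∣ tiltSum (2 ℕ.+ t) n - tiltSum (2 ℕ.+ t) (n ℕ.+ d) ∣ ≤ κ n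
tiltSum-tail t n d = ∣-∣-bounds
  (≤-trans (∑-≤-+ n d (0≤tiltTerm (2 ℕ.+ t))) (p≤p+q _ (0≤κ n)))
  (begin
    tiltSum (2 ℕ.+ t) (n ℕ.+ d)                         ≡⟨ ∑-split n d (tiltTerm (2 ℕ.+ t)) ⟩
    tiltSum (2 ℕ.+ t) n + ∑ d (λ i → tiltTerm (2 ℕ.+ t) (n ℕ.+ i))
                                                        ≤⟨ +-monoʳ-≤ (tiltSum (2 ℕ.+ t) n) (∑-mono d λ i → tiltTerm-≤ t (n ℕ.+ i)) ⟩
    tiltSum (2 ℕ.+ t) n + ∑ d (λ i → tiltTerm 2 (n ℕ.+ i))
                                                        ≤⟨ +-monoʳ-≤ (tiltSum (2 ℕ.+ t) n) tail₂ ⟩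
    tiltSum (2 ℕ.+ t) n + κ n                           ∎)
  where
  open ≤-Reasoning
  tail₂ : ∑ d (λ i → tiltTerm 2 (n ℕ.+ i)) ≤ κ n
  tail₂ = ≤-from-gap (0≤κ (n ℕ.+ d)) (trans
    (cong (λ z → κ n - z) (trans
      (solve 2 (λ a b → b := a :+ b :- a) refl (tiltSum 2 n) (∑ d (λ i → tiltTerm 2 (n ℕ.+ i))))
      (cong₂ _-_ (trans (sym (∑-split n d (tiltTerm 2))) (tiltSum-2 (n ℕ.+ d))) (tiltSum-2 n))))
    (solve 2 (λ a b → a :- (con 1ℚ :- b :- (con 1ℚ :- a)) := b) refl (κ n) (κ (n ℕ.+ d))))

sign : ℕ → ℚ
sign t = (- 1ℚ) ^ t

sign-double : ∀ a → sign (a ℕ.+ a) ≡ 1ℚ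
sign-double zero    = refl
sign-double (suc a) = trans (cong (λ z → - 1ℚ * sign z) (ℕ.+-suc a a))
  (trans (solve 1 (λ s → con (- 1ℚ) :* (con (- 1ℚ) :* s) := s) refl (sign (a ℕ.+ a))) (sign-double a))

∣sign*∣ : ∀ t q → ∣ sign t * q ∣ ≡ ∣ q ∣
∣sign*∣ zero    q = cong ∣_∣ (*-identityˡ q)
∣sign*∣ (suc t) q = trans (cong ∣_∣ (solve 2 (λ s q → con (- 1ℚ) :* s :* q := :- (s :* q)) refl (sign t) q))
  (trans (∣-p∣≡∣p∣ (sign t * q)) (∣sign*∣ t q))

-- The `k`-th approximant of the bracket in the claimed constant.
alternating-ζ : ℕ → ℕ → ℚ
alternating-ζ r k = sign r + ∑ (r ℕ.∸ 2) (λ i → sign (r ℕ.+ (3 ℕ.+ i)) * ζ-partial (2 ℕ.+ i) k)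

-- Exact because `ζ-partial` at k also has k + 1 terms. The only discrepancy is S₂ = 1 - `κ (suc k)`
-- in place of 1, and every step of the recurrence flips its sign.
alternating-ζ≡tiltSum : ∀ t k → alternating-ζ (2 ℕ.+ t) k ≡ tiltSum (2 ℕ.+ t) (suc k) + sign t * κ (suc k)
alternating-ζ≡tiltSum zero    k = sym (trans (cong (_+ 1ℚ * κ (suc k)) (tiltSum-2 (suc k)))
  (solve 1 (λ κ → con 1ℚ :- κ :+ con 1ℚ :* κ := con (- 1ℚ) :* (con (- 1ℚ) :* con 1ℚ) :+ con 0ℚ) refl (κ (suc k))))
alternating-ζ≡tiltSum (suc t) k = begin
  - 1ℚ * σ + (∑ t (λ i → - 1ℚ * sign (2 ℕ.+ t ℕ.+ (3 ℕ.+ i)) * Z i) + sign (3 ℕ.+ t ℕ.+ (3 ℕ.+ t)) * Z t)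
    -- Raising r by one flips all earlier signs; the new last term has j = r, hence the sign
    -- (-1)^(2r) = 1.
    ≡⟨ cong₂ (λ a b → - 1ℚ * σ + (a + b * Z t))
         (trans (∑-cong t λ i → *-assoc (- 1ℚ) (sign (2 ℕ.+ t ℕ.+ (3 ℕ.+ i))) (Z i)) (∑-* t (- 1ℚ) _))
         (sign-double (3 ℕ.+ t)) ⟩
  - 1ℚ * σ + (- 1ℚ * s + 1ℚ * Z t)
    ≡⟨ solve 3 (λ σ s z → con (- 1ℚ) :* σ :+ (con (- 1ℚ) :* s :+ con 1ℚ :* z) := z :- (σ :+ s)) refl σ s (Z t) ⟩
  Z t - (σ + s)
    ≡⟨ cong (λ z → Z t - z) (alternating-ζ≡tiltSum t k) ⟩
  Z t - (tiltSum (2 ℕ.+ t) (suc k) + sign t * κ (suc k))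
    ≡⟨ solve 4 (λ z a s κ → z :- (a :+ s :* κ) := z :- a :+ con (- 1ℚ) :* s :* κ) refl (Z t) (tiltSum (2 ℕ.+ t) (suc k)) (sign t) (κ (suc k)) ⟩
  Z t - tiltSum (2 ℕ.+ t) (suc k) + sign (suc t) * κ (suc k)
    ≡⟨ cong (_+ sign (suc t) * κ (suc k)) (tiltSum-suc (2 ℕ.+ t) (suc k)) ⟨
  tiltSum (3 ℕ.+ t) (suc k) + sign (suc t) * κ (suc k) ∎
  where
  open ≡-Reasoning
  σ s : ℚ
  σ = sign (2 ℕ.+ t)
  Z : ℕ → ℚ
  Z i = ζ-partial (2 ℕ.+ i) k
  s = ∑ t (λ i → sign (2 ℕ.+ t ℕ.+ (3 ℕ.+ i)) * Z i)

tiltSum-near : ∀ {r} → 2 ℕ.≤ r → ∀ {n k} → n ℕ.≤ k → ∣ tiltSum r n - alternating-ζ r k ∣ ≤ κ n + κ n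
tiltSum-near {suc (suc t)} (ℕ.s≤s (ℕ.s≤s _)) {n} {k} n≤k = subst (λ z → ∣ tiltSum (2 ℕ.+ t) n - z ∣ ≤ κ n + κ n) (sym (alternating-ζ≡tiltSum t k))
  (≤-trans (∣-∣-triangle (tiltSum (2 ℕ.+ t) n) T (T + e)) (+-mono-≤
    (subst (λ z → ∣ tiltSum (2 ℕ.+ t) n - tiltSum (2 ℕ.+ t) z ∣ ≤ κ n) (ℕ.m+[n∸m]≡n n≤1+k) (tiltSum-tail t n (suc k ℕ.∸ n)))
    (≤-trans (≤-reflexive (trans (cong ∣_∣ (solve 2 (λ a b → a :- (a :+ b) := :- b) refl T e)) (trans (∣-p∣≡∣p∣ e)
        (trans (∣sign*∣ t (κ (suc k))) (0≤p⇒∣p∣≡p (0≤κ (suc k)))))))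
      (κ-anti n≤1+k))))
  where
  T e : ℚ
  T = tiltSum (2 ℕ.+ t) (suc k)
  e = sign t * κ (suc k)
  n≤1+k : n ℕ.≤ suc k
  n≤1+k = ℕ.m≤n⇒m≤1+n n≤k

-- Approximants of the sums and of the constants.

approx-∑ᴿ : ∀ n f k → approx (∑ᴿ n f) k ≡ ∑ n (λ i → approx (f i) k)
approx-∑ᴿ zero    f k = refl
approx-∑ᴿ (suc n) f k = cong (_+ approx (f n) k) (approx-∑ᴿ n f k)

approx-ρ̃ : ∀ r k → approx (ρ̃ r) k ≡ 1/ r ! * alternating-ζ r k
approx-ρ̃ r k = cong (λ z → 1/ r ! * (sign r + z))
  (approx-∑ᴿ (r ℕ.∸ 2) (λ i → let j = 3 ℕ.+ i in fromℚ ((- 1ℚ) ^ (r ℕ.+ j)) *ᴿ ζ (j ℕ.∸ 1)) k)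

approx-A₁ : ∀ n k → approx (A₁ n) k ≡ weighted (reciprocals n) (log-approx k)
approx-A₁ n k = trans
  (approx-∑ᴿ n (λ i → let m = suc i in logℕ (suc m) *ᴿ fromℚ (elementary m (reciprocals n))) k)
  (trans (sym add-zeroth) (∑-elementary (reciprocals n) n (log-approx k) (ℕ.≤-reflexive (length-reciprocals n))))
  where
  term : ℕ → ℚ
  term m = log-approx k m * elementary m (reciprocals n)
  term-0 : term 0 ≡ 0ℚ
  term-0 = trans (cong (_* 1ℚ) (riemann-1 k)) (*-zeroˡ 1ℚ)
  -- `A₁` starts at m = 1 whereas `weighted` includes m = 0; the extra term is log 1 = 0, exactly so
  -- at every `k`.
  add-zeroth : ∑ (suc n) term ≡ ∑ n (λ i → term (suc i))
  add-zeroth = trans (∑-head n term) (trans (cong (_+ ∑ n (λ i → term (suc i))) term-0) (+-identityˡ (∑ n (λ i → term (suc i)))))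

approx-Ã : ∀ r → 2 ℕ.≤ r → ∀ n k →
  approx (Ã r n) k ≡ 1/ r ! * hookWeighted r (reciprocals n) (λ l → log-approx k (l ℕ.+ r))
approx-Ã r 2≤r n k = cong (1/ r ! *_) (trans
  (approx-∑ᴿ n (λ l → logℕ (suc (l ℕ.+ r)) *ᴿ fromℚ (monomialSymmetric (r ∷ replicate l 1) (reciprocals n))) k)
  (trans
    (∑-cong-< n λ l l<n → cong (log-approx k (l ℕ.+ r) *_)
      (monomialSymmetric-hook r 2≤r (reciprocals n) l (subst (l ℕ.<_) (sym (length-reciprocals n)) l<n)))
    (∑-hookSum r (reciprocals n) n (λ l → log-approx k (l ℕ.+ r)) (ℕ.≤-reflexive (length-reciprocals n)))))

-- The common limit argument.

∣*-*∣ : ∀ {c} → 0ℚ ≤ c → ∀ p q → ∣ c * p - c * q ∣ ≡ c * ∣ p - q ∣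
∣*-*∣ {c} 0≤c p q = trans (cong ∣_∣ (solve 3 (λ c p q → c :* p :- c :* q := c :* (p :- q)) refl c p q))
  (trans (∣p*q∣≡∣p∣*∣q∣ c (p - q)) (cong (_* ∣ p - q ∣) (0≤p⇒∣p∣≡p 0≤c)))

-- Three errors of size η: the bounded error C against X, the factor 1 + ν against ν, and S against
-- L. The bound 1 + ν ≤ 2 ν is why C is doubled in the hypothesis.
quotient-near : ∀ A S L X ν C η → 0ℚ < X → 1ℚ ≤ ν → 0ℚ ≤ S → S ≤ 1ℚ → 0ℚ ≤ C →
  ∣ A - S * ((1ℚ + ν) * X) ∣ ≤ S * ((1ℚ + ν) * C) →
  ∣ S - L ∣ ≤ η → C + C ≤ X * η → 1ℚ ≤ ν * η →
  ∣ A * inv (ν * X) - L ∣ ≤ η + η + η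
quotient-near A S L X ν C η 0<X 1≤ν 0≤S S≤1 0≤C main S-L 2C≤ 1≤νη = begin
  ∣ A * inv D - L ∣
    ≡⟨ cong (λ z → ∣ A * inv D - z ∣) (trans (sym (*-identityʳ L)) (cong (L *_) (sym D-inv))) ⟩
  ∣ A * inv D - L * (D * inv D) ∣
    ≡⟨ cong ∣_∣ (solve 4 (λ a l d i → a :* i :- l :* (d :* i) := i :* a :- i :* (l :* d)) refl A L D (inv D)) ⟩
  ∣ inv D * A - inv D * (L * D) ∣
    ≡⟨ ∣*-*∣ 0≤invD A (L * D) ⟩
  inv D * ∣ A - L * D ∣
    ≤⟨ *-monoʳ 0≤invD numerator ⟩
  inv D * (D * η + (D * η + D * η))
    ≡⟨ solve 3 (λ d i η → i :* (d :* η :+ (d :* η :+ d :* η)) := (d :* i) :* (η :+ η :+ η)) refl D (inv D) η ⟩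
  (D * inv D) * (η + η + η)
    ≡⟨ trans (cong (_* (η + η + η)) D-inv) (*-identityˡ _) ⟩
  η + η + η ∎
  where
  open ≤-Reasoning
  D : ℚ
  D = ν * X
  0<ν : 0ℚ < ν
  0<ν = <-≤-trans (positive⁻¹ 1ℚ) 1≤ν
  0<D : 0ℚ < D
  0<D = *-pos 0<ν 0<X
  0≤invD : 0ℚ ≤ inv D
  0≤invD = 0≤inv 0<D
  D-inv : D * inv D ≡ 1ℚ
  D-inv = *-inv D (pos≢0 0<D)
  first : S * ((1ℚ + ν) * C) ≤ D * η
  first = begin
    S * ((1ℚ + ν) * C)   ≤⟨ *-monoˡ (*-nonneg (<⇒≤ (0<1+ (<⇒≤ 0<ν))) 0≤C) S≤1 ⟩
    1ℚ * ((1ℚ + ν) * C)  ≤⟨ *-monoʳ (<⇒≤ (positive⁻¹ 1ℚ)) (*-monoˡ 0≤C (+-monoˡ-≤ ν 1≤ν)) ⟩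
    1ℚ * ((ν + ν) * C)   ≡⟨ solve 2 (λ ν c → con 1ℚ :* ((ν :+ ν) :* c) := ν :* (c :+ c)) refl ν C ⟩
    ν * (C + C)          ≤⟨ *-monoʳ (<⇒≤ 0<ν) 2C≤ ⟩
    ν * (X * η)          ≡⟨ *-assoc ν X η ⟨
    D * η                ∎
  second : ∣ S * ((1ℚ + ν) * X) - S * D ∣ ≤ D * η
  second = begin
    ∣ S * ((1ℚ + ν) * X) - S * (ν * X) ∣  ≡⟨ cong ∣_∣ (solve 3 (λ s ν x → s :* ((con 1ℚ :+ ν) :* x) :- s :* (ν :* x) := s :* x) refl S ν X) ⟩
    ∣ S * X ∣                             ≡⟨ 0≤p⇒∣p∣≡p (*-nonneg 0≤S (<⇒≤ 0<X)) ⟩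
    S * X                                 ≤⟨ *-monoˡ (<⇒≤ 0<X) (≤-trans S≤1 1≤νη) ⟩
    (ν * η) * X                           ≡⟨ solve 3 (λ ν η x → ν :* η :* x := ν :* x :* η) refl ν η X ⟩
    D * η                                 ∎
  third : ∣ S * D - L * D ∣ ≤ D * η
  third = begin
    ∣ S * D - L * D ∣    ≡⟨ cong₂ (λ a b → ∣ a - b ∣) (*-comm S D) (*-comm L D) ⟩
    ∣ D * S - D * L ∣    ≡⟨ ∣*-*∣ (<⇒≤ 0<D) S L ⟩
    D * ∣ S - L ∣        ≤⟨ *-monoʳ (<⇒≤ 0<D) S-L ⟩
    D * η                ∎
  numerator : ∣ A - L * D ∣ ≤ D * η + (D * η + D * η)
  numerator = ≤-trans (∣-∣-triangle A (S * ((1ℚ + ν) * X)) (L * D)) (+-mono-≤ (≤-trans main first)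
    (≤-trans (∣-∣-triangle (S * ((1ℚ + ν) * X)) (S * D) (L * D)) (+-mono-≤ second third)))

nloglog-defined : ∀ n {{_ : ℕ.NonZero n}} → (∀ k → n ℕ.≤ k → 1ℚ ≤ riemann (ι n) k) →
                  (∀ k → n ℕ.≤ k → 1ℚ ≤ riemann (riemann (ι n) k) k) → Defined n
nloglog-defined n {{n≢0}} 1≤ℓ 1≤X = record
  { n≢0   = n≢0
  ; 0<log = 1ℚ , positive⁻¹ 1ℚ , n , λ k n≤k → ≤-trans (≤-reflexive (+-identityˡ 1ℚ)) (1≤ℓ k n≤k)
  ; apart = inj₂ (1ℚ , positive⁻¹ 1ℚ , n , λ k n≤k → ≤-trans (≤-reflexive (+-identityˡ 1ℚ)) (1≤nX k n≤k))
  }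
  where
  1≤n : 1ℚ ≤ ι n
  1≤n = ι-mono {1} {n} (ℕ.>-nonZero⁻¹ n)
  1≤nX : ∀ k → n ℕ.≤ k → 1ℚ ≤ ι n * riemann (riemann (ι n) k) k
  1≤nX k n≤k = *-mono {1ℚ} {ι n} {1ℚ} (<⇒≤ (positive⁻¹ 1ℚ)) 1≤n (<⇒≤ (positive⁻¹ 1ℚ)) (1≤X k n≤k)

-- True by unfolding: the approximants of the quotient do not depend on the proofs packed in `d`, so
-- any witness of `Defined n` will do.
eventually-< : ∀ A L n (d : Defined n) ε η K → 0ℚ < η →
  (∀ k → K ℕ.≤ k → ∣ approx (A n) k * inv (ι n * riemann (riemann (ι n) k) k) - approx L k ∣ + η ≤ approx ε k) →
  ∣ (A /nloglog) n d -ᴿ L ∣ᴿ <ᴿ ε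
eventually-< A L n d ε η K 0<η bound = η , 0<η , K , bound

-- X stands for log log n, of which only its distance from log Hₙ₊₁ matters.
module _ (A : ℕ → ℝ) (L : ℝ) (S : ℕ → ℚ) (C : ℕ)
  (0≤S : ∀ n → 0ℚ ≤ S n) (S≤1 : ∀ n → S n ≤ 1ℚ)
  (S-near : ∀ n k → n ℕ.≤ k → ∣ S n - approx L k ∣ ≤ κ n + κ n)
  (A-near : ∀ n k X → n ℕ.≤ k → ∣ riemann (1ℚ + harmonic n) k - X ∣ ≤ ι 2 →
            ∣ approx (A n) k - S n * (ι (suc n) * X) ∣ ≤ S n * (ι (suc n) * ι C))
  where

  -- From `κ N + κ N ≤ η` follows 2 ≤ (N + 1) η, so X ≥ (N + 1) C gives 2 C ≤ X η. The outer `suc`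
  -- in the threshold keeps X positive when C = 0.
  quotient-close : ∀ {η} N → 0ℚ < η → κ N + κ N ≤ η → ∀ n .{{_ : ℕ.NonZero n}} k → N ℕ.< n → n ℕ.≤ k →
    1ℚ ≤ riemann (ι n) k → ι (suc (suc N ℕ.* C)) ≤ riemann (riemann (ι n) k) k →
    ∣ approx (A n) k * inv (ι n * riemann (riemann (ι n) k) k) - approx L k ∣ ≤ η + η + η
  quotient-close {η} N 0<η 2κ≤η n k N<n n≤k 1≤ℓ B≤X = quotient-near (approx (A n) k) (S n) (approx L k) X (ι n) (ι C) η
    (<-≤-trans (positive⁻¹ 1ℚ) (≤-trans (1≤ι-suc (suc N ℕ.* C)) B≤X)) 1≤n (0≤S n) (S≤1 n) (0≤ι C)
    (subst (λ z → ∣ approx (A n) k - S n * (z * X) ∣ ≤ S n * (z * ι C)) (ι-suc n)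
      (A-near n k X n≤k (log-log-near n k n≤k 1≤ℓ)))
    (≤-trans (S-near n k n≤k) (≤-trans (+-mono-≤ κn≤ κn≤) 2κ≤η))
    (begin
      ι C + ι C                        ≡⟨ solve 1 (λ c → c :+ c := (con 1ℚ :+ con 1ℚ) :* c) refl (ι C) ⟩
      (1ℚ + 1ℚ) * ι C                  ≤⟨ *-monoˡ (0≤ι C) 2≤Nη ⟩
      ι (suc N) * η * ι C              ≡⟨ solve 3 (λ n η c → n :* η :* c := n :* c :* η) refl (ι (suc N)) η (ι C) ⟩
      ι (suc N) * ι C * η              ≡⟨ cong (_* η) (ι-* (suc N) C) ⟨
      ι (suc N ℕ.* C) * η              ≤⟨ *-monoˡ 0≤η (≤-trans (ι-mono (ℕ.n≤1+n (suc N ℕ.* C))) B≤X) ⟩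
      X * η                            ∎)
    (begin
      1ℚ                               ≤⟨ p≤p+q 1ℚ (<⇒≤ (positive⁻¹ 1ℚ)) ⟩
      1ℚ + 1ℚ                          ≤⟨ 2≤Nη ⟩
      ι (suc N) * η                    ≤⟨ *-monoˡ 0≤η (ι-mono N<n) ⟩
      ι n * η                          ∎)
    where
    open ≤-Reasoning
    X : ℚ
    X = riemann (riemann (ι n) k) k
    0≤η : 0ℚ ≤ η
    0≤η = <⇒≤ 0<η
    1≤n : 1ℚ ≤ ι n
    1≤n = ι-mono {1} {n} (ℕ.>-nonZero⁻¹ n)
    κn≤ : κ n ≤ κ N
    κn≤ = κ-anti (ℕ.<⇒≤ N<n)
    2≤Nη : 1ℚ + 1ℚ ≤ ι (suc N) * η
    2≤Nη = begin
      1ℚ + 1ℚ                              ≡⟨ cong₂ _+_ (ι-κ N) (ι-κ N) ⟨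
      ι (suc N) * κ N + ι (suc N) * κ N    ≡⟨ *-distribˡ-+ (ι (suc N)) (κ N) (κ N) ⟨
      ι (suc N) * (κ N + κ N)              ≤⟨ *-monoʳ (0≤ι (suc N)) 2κ≤η ⟩
      ι (suc N) * η                        ∎

  module _ {ε : ℝ} {e : ℚ} (0<e : 0ℚ < e) {K : ℕ} (e≤ε : ∀ k → K ℕ.≤ k → 0ℚ + e ≤ approx ε k) where

    private
      η : ℚ
      -- A quarter of `e`: three quarters cover the errors of `quotient-near`, the fourth is the gap
      -- demanded by `<ᴿ`.
      η = e * κ 3
      0<η : 0ℚ < η
      0<η = *-pos 0<e (0<κ 3)

    converges-at : ∀ N → κ N + κ N ≤ e * κ 3 → ∀ n {{_ : ℕ.NonZero n}} → N ℕ.< n →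
      (∀ k → n ℕ.≤ k → 1ℚ ≤ riemann (ι n) k × ι (suc (suc N ℕ.* C)) ≤ riemann (riemann (ι n) k) k) →
      Defined n × (∀ (d : Defined n) → ∣ (A /nloglog) n d -ᴿ L ∣ᴿ <ᴿ ε)
    converges-at N 2κ≤η n N<n large =
      nloglog-defined n (λ k n≤k → proj₁ (large k n≤k))
        (λ k n≤k → ≤-trans (1≤ι-suc (suc N ℕ.* C)) (proj₂ (large k n≤k))) ,
      λ d → eventually-< A L n d ε η (n ℕ.⊔ K) 0<η λ k ≤k →
        let n≤k = ℕ.m⊔n≤o⇒m≤o n K ≤k in
        ≤-trans (+-monoˡ-≤ η (quotient-close N 0<η 2κ≤η n k N<n n≤k (proj₁ (large k n≤k)) (proj₂ (large k n≤k))))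
          (≤-trans (≤-reflexive 4η≡e) (e≤ε k (ℕ.m⊔n≤o⇒n≤o n K ≤k)))
      where
      4η≡e : η + η + η + η ≡ 0ℚ + e
      4η≡e = solve 1 (λ e → e :* con (κ 3) :+ e :* con (κ 3) :+ e :* con (κ 3) :+ e :* con (κ 3) := con 0ℚ :+ e) refl e

  converges : (A /nloglog) ⟶ L
  converges ε (e , 0<e , K , e≤ε) =
    let N , κ≤   = archimedean (e * κ 3 * ½) (*-pos (*-pos 0<e (0<κ 3)) (positive⁻¹ ½))
        M , large = log-log-large (suc (suc N ℕ.* C))
        2κ≤η     = ≤-trans (+-mono-≤ (κ≤ N ℕ.≤-refl) (κ≤ N ℕ.≤-refl))
                     (≤-reflexive (solve 1 (λ η → η :* con ½ :+ η :* con ½ := η) refl (e * κ 3)))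
    in suc N ℕ.⊔ M , λ n ≤n →
      let N<n = ℕ.m⊔n≤o⇒m≤o (suc N) M ≤n
          n≢0 = ℕ.>-nonZero (ℕ.≤-trans (ℕ.s≤s ℕ.z≤n) N<n)
      in converges-at {ε} 0<e e≤ε N 2κ≤η n {{n≢0}} N<n (λ k n≤k → large n {{n≢0}} k (ℕ.m⊔n≤o⇒n≤o (suc N) M ≤n) n≤k)

-- The two families of sums in the common argument.

1/-bounds : ∀ m .{{_ : ℕ.NonZero m}} → 0ℚ ≤ ℤ.+ 1 / m × ℤ.+ 1 / m ≤ 1ℚ
1/-bounds (suc m) = 0≤κ m , κ≤1 m

module _ (n k : ℕ) (X : ℚ) (n≤k : n ℕ.≤ k) (near : ∣ riemann (1ℚ + harmonic n) k - X ∣ ≤ ι 2) where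

  private
    xs : List ℚ
    xs = reciprocals n
    cκ≤1 : (1ℚ + mean xs) * κ k ≤ 1ℚ
    cκ≤1 = ≤-trans (*-monoˡ (0≤κ k) (subst (λ z → 1ℚ + z ≤ ι (suc n)) (sym (mean-reciprocals n)) (harmonic-≤ n)))
      (ι*κ≤1′ (ℕ.s≤s n≤k))
    near′ : ∣ riemann (1ℚ + mean xs) k - X ∣ ≤ ι 2
    near′ = subst (λ z → ∣ riemann (1ℚ + z) k - X ∣ ≤ ι 2) (sym (mean-reciprocals n)) near

  A₁-near : ∣ approx (A₁ n) k - 1ℚ * (ι (suc n) * X) ∣ ≤ 1ℚ * (ι (suc n) * ι 5)
  A₁-near = subst₂ (λ a p → ∣ a - 1ℚ * (p * X) ∣ ≤ 1ℚ * (p * ι 5)) (sym (approx-A₁ n k)) (mass-reciprocals n)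
    (weighted-log-near (reciprocals-nonneg n) k cκ≤1 near′)

  Ã-near : ∀ r → 2 ℕ.≤ r →
    ∣ approx (Ã r n) k - 1/ r ! * tiltSum r n * (ι (suc n) * X) ∣ ≤ 1/ r ! * tiltSum r n * (ι (suc n) * ι (5 ℕ.+ r))
  Ã-near r 2≤r = subst₂ _≤_
    (sym (trans (cong₂ (λ a b → ∣ a - b ∣) (approx-Ã r 2≤r n k) (*-assoc c (tiltSum r n) (ι (suc n) * X))) (∣*-*∣ 0≤c V (tiltSum r n * (ι (suc n) * X)))))
    (sym (*-assoc c (tiltSum r n) (ι (suc n) * ι (5 ℕ.+ r))))
    (*-monoʳ 0≤c (subst₂ (λ s p → ∣ V - s * (p * X) ∣ ≤ s * (p * ι (5 ℕ.+ r)))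
      (sum-reciprocals (λ x → x ^ r * inv (1ℚ + x)) n) (mass-reciprocals n)
      (hookWeighted-log-near (reciprocals-nonneg n) k cκ≤1 near′ r)))
    where
    c V : ℚ
    c = 1/ r !
    V = hookWeighted r xs (λ l → log-approx k (l ℕ.+ r))
    0≤c : 0ℚ ≤ c
    0≤c = proj₁ (1/-bounds (r !) {{r ℕ.!≢0}})

A₁-limit : (A₁ /nloglog) ⟶ 1ᴿ
A₁-limit = converges A₁ 1ᴿ (λ _ → 1ℚ) 5 (λ _ → <⇒≤ (positive⁻¹ 1ℚ)) (λ _ → ≤-refl)
  (λ n k _ → ≤-trans (≤-reflexive (cong ∣_∣ (+-inverseʳ 1ℚ))) (+-nonneg (0≤κ n) (0≤κ n))) A₁-near

Ã-limit : ∀ r → 2 ℕ.≤ r → (Ã r /nloglog) ⟶ ρ̃ r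
Ã-limit r 2≤r = converges (Ã r) (ρ̃ r) (λ n → c * tiltSum r n) (5 ℕ.+ r)
  (λ n → *-nonneg 0≤c (∑-nonneg n (0≤tiltTerm r)))
  (λ n → ≤-trans (*-monoʳ 0≤c (tiltSum-≤1 2≤r n)) (≤-trans (≤-reflexive (*-identityʳ c)) c≤1))
  (λ n k n≤k → ≤-trans (≤-reflexive (trans (cong (λ z → ∣ c * tiltSum r n - z ∣) (approx-ρ̃ r k)) (∣*-*∣ 0≤c (tiltSum r n) (alternating-ζ r k))))
    (≤-trans (*-mono 0≤c c≤1 (0≤∣p∣ (tiltSum r n - alternating-ζ r k)) (tiltSum-near 2≤r n≤k)) (≤-reflexive (*-identityˡ (κ n + κ n)))))
  (λ n k X n≤k near → Ã-near n k X n≤k near r 2≤r)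
  where
  c : ℚ
  c = 1/ r !
  0≤c : 0ℚ ≤ c
  0≤c = proj₁ (1/-bounds (r !) {{r ℕ.!≢0}})
  c≤1 : c ≤ 1ℚ
  c≤1 = proj₂ (1/-bounds (r !) {{r ℕ.!≢0}})

theorem7 : ((A₁ /nloglog) ⟶ 1ᴿ) × (∀ (r : ℕ) → 2 ℕ.≤ r → (Ã r /nloglog) ⟶ ρ̃ r)
theorem7 = A₁-limit , Ã-limit
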